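{- The number of rank-3 matroids on ground set $[n]=\{1,\dots,n\}$ that have no minor isomorphic to $\mathcal{W}^3$ or to $M(K_4)$ is $2^{o(n^2)}$ as $n\to\infty$.
   Context: $\mathcal{W}^3$ is the rank-3 whirl: the rank-3 matroid on a 6-element set $\{a,b,c,d,e,f\}$ whose only dependent 3-sets are $\{a,b,c\},\{c,d,e\},\{e,f,a\}$. $M(K_4)$ is the cycle matroid of $K_4$; equivalently the rank-3 matroid on $\{a,b,c,d,e,f\}$ whose only dependent 3-sets are $\{a,b,c\},\{c,d,e\},\{e,f,a\},\{b,d,f\}$. Matroids are counted as labelled matroids on $[n]$. -}

module Defs where

open import Data.Empty using (⊥-elim)
open import Data.Fin using (Fin; #_)
open import Data.Fin.Properties using (any?)
open import Data.Fin.Subset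
open import Data.Fin.Subset.Properties
open import Data.List using (List; []; _∷_)
open import Data.List.Membership.Propositional using () renaming (_∉_ to _∉ₗ_)
open import Data.Nat using (ℕ; zero; suc; _+_; _*_; _^_; _≤_; _<_; NonZero; _≤?_; _<?_)
open import Data.Nat.Properties
  using (≤-trans; ≤-refl; ≤-reflexive; ≤-antisym; +-suc; +-identityʳ; ≰⇒>; +-monoˡ-≤; <-irrefl; module ≤-Reasoning)
open import Data.Product using (∃; ∃-syntax; _×_; _,_; proj₁; proj₂)
open import Data.Sum using (inj₁; inj₂; [_,_]′)
open import Data.Vec using ([]; _∷_; here; there)
open import Data.Vec.Properties using (≡-dec)
open import Function using (_∘_; id)
open import Function.Bundles using (_⇔_; _↔_; mk⇔; Equivalence; Inverse)
open import Level using (0ℓ; Level)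
open import Relation.Binary.Bundles using (Setoid)
open import Relation.Binary.PropositionalEquality
  using (_≡_; refl; sym; trans; cong; subst; setoid)
open import Relation.Nullary using (¬_; Dec; yes; no; ¬?; contradiction)
open import Relation.Nullary.Decidable using (map′; _×-dec_; _→-dec_; decidable-stable; True; toWitness)
open import Relation.Unary using (Pred; Decidable)

import Data.Bool.Properties as Bool
import Data.List.Membership.DecPropositional as DecMembership

private
  variable
    ℓ : Level
    m n : ℕ

allSubset? : {P : Pred (Subset n) ℓ} → Decidable P → Dec (∀ X → P X)
allSubset? P? = map′
  (λ ¬∃¬ X → decidable-stable (P? X) (λ ¬PX → ¬∃¬ (X , ¬PX)))
  (λ ∀P (X , ¬PX) → ¬PX (∀P X))
  (¬? (anySubset? (¬? ∘ P?)))

-- Independence is required to be decidable so that a matroid is finite data,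
-- as it is classically.
record Matroid (n : ℕ) : Set₁ where
  field
    ground       : Subset n
    Indep        : Pred (Subset n) 0ℓ
    indep?       : Decidable Indep
    indep⊆ground : ∀ {X} → Indep X → X ⊆ ground
    ∅-indep      : Indep ⊥
    hereditary   : ∀ {X Y} → Indep Y → X ⊆ Y → Indep X
    augmentation : ∀ {X Y} → Indep X → Indep Y → ∣ X ∣ < ∣ Y ∣ →
                   ∃[ x ] x ∈ Y × x ∉ X × Indep (X ∪ ⁅ x ⁆)

open Matroid

record IsBasisOf (M : Matroid n) (T B : Subset n) : Set where
  field
    B⊆T     : B ⊆ T
    indep   : Indep M B
    maximal : ∀ {X} → X ⊆ T → Indep M X → B ⊆ X → X ⊆ B

open IsBasisOf

HasRank : Matroid n → ℕ → Set
HasRank M r = ∃[ B ] IsBasisOf M (ground M) B × ∣ B ∣ ≡ r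

∪-lub : ∀ {X Y Z : Subset n} → X ⊆ Z → Y ⊆ Z → X ∪ Y ⊆ Z
∪-lub {X = X} {Y} X⊆Z Y⊆Z x∈ = [ X⊆Z , Y⊆Z ]′ (x∈p∪q⁻ X Y x∈)

∪-mono : ∀ {X X′ Y Y′ : Subset n} → X ⊆ X′ → Y ⊆ Y′ → X ∪ Y ⊆ X′ ∪ Y′
∪-mono X⊆ Y⊆ = ∪-lub (p⊆p∪q _ ∘ X⊆) (q⊆p∪q _ _ ∘ Y⊆)

⁅⁆⊆ : ∀ {x} {X : Subset n} → x ∈ X → ⁅ x ⁆ ⊆ X
⁅⁆⊆ {x = x} x∈X y∈ = subst (_∈ _) (sym (x∈⁅y⁆⇒x≡y x y∈)) x∈X

x∈p─q⇒x∉q : ∀ {x} (p q : Subset n) → x ∈ p ─ q → x ∉ q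
x∈p─q⇒x∉q (_ ∷ p) (outside ∷ q) (there x∈) (there x∈q) = x∈p─q⇒x∉q p q x∈ x∈q
x∈p─q⇒x∉q (_ ∷ p) (inside ∷ q) (there x∈) (there x∈q) = x∈p─q⇒x∉q p q x∈ x∈q

∣∪∣-disjoint : ∀ (p q : Subset n) → (∀ {x} → x ∈ p → x ∉ q) → ∣ p ∪ q ∣ ≡ ∣ p ∣ + ∣ q ∣
∣∪∣-disjoint []            []            d = refl
∣∪∣-disjoint (outside ∷ p) (outside ∷ q) d = ∣∪∣-disjoint p q (λ x y → d (there x) (there y))
∣∪∣-disjoint (inside  ∷ p) (outside ∷ q) d = cong suc (∣∪∣-disjoint p q (λ x y → d (there x) (there y)))
∣∪∣-disjoint (outside ∷ p) (inside  ∷ q) d =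
  trans (cong suc (∣∪∣-disjoint p q (λ x y → d (there x) (there y)))) (sym (+-suc _ _))
∣∪∣-disjoint (inside  ∷ p) (inside  ∷ q) d = ⊥-elim (d here here)

isBasisOf? : (M : Matroid n) (T : Subset n) → Decidable (IsBasisOf M T)
isBasisOf? M T B = map′ to from
  ((B ⊆? T) ×-dec indep? M B ×-dec
    allSubset? (λ X → (X ⊆? T) →-dec (indep? M X →-dec ((B ⊆? X) →-dec (X ⊆? B)))))
  where
  Conditions : Set
  Conditions = B ⊆ T × Indep M B × (∀ X → X ⊆ T → Indep M X → B ⊆ X → X ⊆ B)

  to : Conditions → IsBasisOf M T B
  to (B⊆T , iB , max) = record { B⊆T = B⊆T ; indep = iB ; maximal = λ {X} → max X }

  from : IsBasisOf M T B → Conditions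
  from b = B⊆T b , indep b , λ _ → maximal b

noExtension⇒basis : (M : Matroid n) {T B : Subset n} → B ⊆ T → Indep M B →
  (∀ {x} → x ∈ T → x ∉ B → ¬ Indep M (B ∪ ⁅ x ⁆)) → IsBasisOf M T B
noExtension⇒basis M {T} {B} B⊆T iB stuck = record
  { B⊆T = B⊆T ; indep = iB
  ; maximal = λ X⊆T iX B⊆X {x} x∈X → decidable-stable (x ∈? B)
      (λ x∉B → stuck (X⊆T x∈X) x∉B (hereditary M iX (∪-lub B⊆X (⁅⁆⊆ x∈X))))
  }

extendToBasis : (M : Matroid n) (T : Subset n) (k : ℕ) (B : Subset n) → n < ∣ B ∣ + k →
  B ⊆ T → Indep M B → ∃ (IsBasisOf M T)
extendToBasis M T zero B n< B⊆T iB =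
  contradiction (≤-trans n< (≤-trans (≤-reflexive (+-identityʳ _)) (∣p∣≤n B))) (<-irrefl refl)
extendToBasis M T (suc k) B n< B⊆T iB
  with any? (λ x → (x ∈? T) ×-dec ¬? (x ∈? B) ×-dec indep? M (B ∪ ⁅ x ⁆))
... | no stuck = B , noExtension⇒basis M B⊆T iB (λ x∈T x∉B i → stuck (_ , x∈T , x∉B , i))
... | yes (x , x∈T , x∉B , i) =
  extendToBasis M T k (B ∪ ⁅ x ⁆)
    (≤-trans n< (≤-trans (≤-reflexive (+-suc _ k)) (+-monoˡ-≤ k
      (p⊂q⇒∣p∣<∣q∣ (p⊆p∪q ⁅ x ⁆ , x , q⊆p∪q B ⁅ x ⁆ (x∈⁅x⁆ x) , x∉B)))))
    (∪-lub B⊆T (⁅⁆⊆ x∈T)) i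

basis : (M : Matroid n) (T : Subset n) → ∃ (IsBasisOf M T)
basis {n} M T = extendToBasis M T (suc n) ⊥
  (subst (λ z → n < z + suc n) (sym (∣⊥∣≡0 n)) ≤-refl) ⊥⊆ (∅-indep M)

basis-≤ : (M : Matroid n) {T B X : Subset n} → IsBasisOf M T B → X ⊆ T → Indep M X → ∣ X ∣ ≤ ∣ B ∣
basis-≤ M {B = B} {X} bB X⊆T iX with ∣ X ∣ ≤? ∣ B ∣
... | yes p = p
... | no ¬p with augmentation M (indep bB) iX (≰⇒> ¬p)
...   | x , x∈X , x∉B , i = contradiction
  (maximal bB (∪-lub (B⊆T bB) (⁅⁆⊆ (X⊆T x∈X))) i (p⊆p∪q ⁅ x ⁆) (q⊆p∪q B ⁅ x ⁆ (x∈⁅x⁆ x))) x∉B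

infixl 7 _∖_ _／_

_∖_ : Matroid n → Subset n → Matroid n
M ∖ T = record
  { ground       = ground M ─ T
  ; Indep        = λ X → X ⊆ ground M ─ T × Indep M X
  ; indep?       = λ X → (X ⊆? _) ×-dec indep? M X
  ; indep⊆ground = proj₁
  ; ∅-indep      = ⊥⊆ , ∅-indep M
  ; hereditary   = λ (Y⊆ , iY) X⊆Y → Y⊆ ∘ X⊆Y , hereditary M iY X⊆Y
  ; augmentation = λ (X⊆ , iX) (Y⊆ , iY) X<Y →
      let x , x∈Y , x∉X , i = augmentation M iX iY X<Y
      in  x , x∈Y , x∉X , ∪-lub X⊆ (⁅⁆⊆ (Y⊆ x∈Y)) , i
  }

_／_ : Matroid n → Subset n → Matroid n
M ／ T = record
  { ground       = ground M ─ T
  ; Indep        = λ X → X ⊆ ground M ─ T × ∃[ B ] IsBasisOf M T B × Indep M (X ∪ B)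
  ; indep?       = λ X → (X ⊆? _) ×-dec anySubset? (λ B → isBasisOf? M T B ×-dec indep? M (X ∪ B))
  ; indep⊆ground = proj₁
  ; ∅-indep      = let B , b = basis M T
                   in  ⊥⊆ , B , b , hereditary M (indep b) (∪-lub ⊥⊆ id)
  ; hereditary   = λ (Y⊆ , B , b , i) X⊆Y → Y⊆ ∘ X⊆Y , B , b , hereditary M i (∪-mono X⊆Y id)
  ; augmentation = aug
  }
  where
  disjoint : ∀ {X B} → X ⊆ ground M ─ T → IsBasisOf M T B → ∀ {x} → x ∈ X → x ∉ B
  disjoint X⊆ b x∈X x∈B = x∈p─q⇒x∉q (ground M) T (X⊆ x∈X) (B⊆T b x∈B)

  aug : ∀ {X Y} →
    X ⊆ ground M ─ T × ∃[ B ] IsBasisOf M T B × Indep M (X ∪ B) →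
    Y ⊆ ground M ─ T × ∃[ B ] IsBasisOf M T B × Indep M (Y ∪ B) →
    ∣ X ∣ < ∣ Y ∣ →
    ∃[ x ] x ∈ Y × x ∉ X × X ∪ ⁅ x ⁆ ⊆ ground M ─ T ×
      ∃[ B ] IsBasisOf M T B × Indep M ((X ∪ ⁅ x ⁆) ∪ B)
  aug {X} {Y} (X⊆ , B , b , iX) (Y⊆ , C , c , iY) X<Y
    with augmentation M iX iY smaller
    where
    open ≤-Reasoning
    smaller : ∣ X ∪ B ∣ < ∣ Y ∪ C ∣
    smaller = begin-strict
      ∣ X ∪ B ∣        ≡⟨ ∣∪∣-disjoint X B (disjoint X⊆ b) ⟩
      ∣ X ∣ + ∣ B ∣    <⟨ +-monoˡ-≤ ∣ B ∣ X<Y ⟩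
      ∣ Y ∣ + ∣ B ∣    ≡⟨ cong (∣ Y ∣ +_) (≤-antisym (basis-≤ M c (B⊆T b) (indep b))
                                                     (basis-≤ M b (B⊆T c) (indep c))) ⟩
      ∣ Y ∣ + ∣ C ∣    ≡⟨ ∣∪∣-disjoint Y C (disjoint Y⊆ c) ⟨
      ∣ Y ∪ C ∣        ∎
  ... | x , x∈ , x∉ , i with x∈p∪q⁻ Y C x∈
  ...   | inj₁ x∈Y = x , x∈Y , x∉ ∘ p⊆p∪q B , ∪-lub X⊆ (⁅⁆⊆ (Y⊆ x∈Y)) , B , b ,
          hereditary M i (∪-lub (∪-mono (p⊆p∪q B) id) (p⊆p∪q ⁅ x ⁆ ∘ q⊆p∪q X B))
  ...   | inj₂ x∈C = contradiction
          (q⊆p∪q X B (maximal b (∪-lub (B⊆T b) (⁅⁆⊆ (B⊆T c x∈C)))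
            (hereditary M i (∪-mono (q⊆p∪q X B) id))
            (p⊆p∪q ⁅ x ⁆) (q⊆p∪q B ⁅ x ⁆ (x∈⁅x⁆ x)))) x∉

Element : Matroid n → Set
Element M = ∃[ x ] x ∈ ground M

-- The hypothesis of `preserves` says that Y is the image of X under the bijection.
record _≅_ (M : Matroid m) (N : Matroid n) : Set where
  field
    bijection : Element M ↔ Element N
    preserves : ∀ {X Y} → X ⊆ ground M → Y ⊆ ground N →
                (∀ e → proj₁ e ∈ X ⇔ proj₁ (Inverse.to bijection e) ∈ Y) →
                Indep M X ⇔ Indep N Y

HasMinor : Matroid m → Matroid n → Set
HasMinor M N = ∃[ C ] ∃[ D ] C ⊆ ground M × D ⊆ ground M × Empty (C ∩ D) × ((M ／ C) ∖ D) ≅ N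

module _ (lines : List (Subset 6)) where
  open DecMembership {A = Subset 6} (≡-dec Bool._≟_) using (_∉?_)

  IndepAvoiding : Pred (Subset 6) 0ℓ
  IndepAvoiding X = ∣ X ∣ ≤ 3 × X ∉ₗ lines

  indepAvoiding? : Decidable IndepAvoiding
  indepAvoiding? X = (∣ X ∣ ≤? 3) ×-dec (X ∉? lines)

  axioms? : Dec
    (IndepAvoiding ⊥ ×
     (∀ Y → IndepAvoiding Y → ∀ X → X ⊆ Y → IndepAvoiding X) ×
     (∀ X → IndepAvoiding X → ∀ Y → IndepAvoiding Y → ∣ X ∣ < ∣ Y ∣ →
       ∃[ x ] x ∈ Y × x ∉ X × IndepAvoiding (X ∪ ⁅ x ⁆)))
  axioms? =
    indepAvoiding? ⊥ ×-dec
    allSubset? (λ Y → indepAvoiding? Y →-dec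
      allSubset? (λ X → (X ⊆? Y) →-dec indepAvoiding? X)) ×-dec
    allSubset? (λ X → indepAvoiding? X →-dec
      allSubset? (λ Y → indepAvoiding? Y →-dec ((∣ X ∣ <? ∣ Y ∣) →-dec
        any? (λ x → (x ∈? Y) ×-dec ¬? (x ∈? X) ×-dec indepAvoiding? (X ∪ ⁅ x ⁆)))))

  sixElementMatroid : {True axioms?} → Matroid 6
  sixElementMatroid {ok} =
    let ∅-ok , hered , aug = toWitness ok in record
    { ground       = ⊤
    ; Indep        = IndepAvoiding
    ; indep?       = indepAvoiding?
    ; indep⊆ground = λ _ → ⊆⊤
    ; ∅-indep      = ∅-ok
    ; hereditary   = λ iY → hered _ iY _
    ; augmentation = λ iX iY → aug _ iX _ iY
    }

private
  a b c d e f : Fin 6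
  a = # 0
  b = # 1
  c = # 2
  d = # 3
  e = # 4
  f = # 5

  triple : Fin 6 → Fin 6 → Fin 6 → Subset 6
  triple x y z = ⁅ x ⁆ ∪ ⁅ y ⁆ ∪ ⁅ z ⁆

𝒲³ : Matroid 6
𝒲³ = sixElementMatroid (triple a b c ∷ triple c d e ∷ triple e f a ∷ [])

M[K₄] : Matroid 6
M[K₄] = sixElementMatroid
  (triple a b c ∷ triple c d e ∷ triple e f a ∷ triple b d f ∷ [])

record Rank3Excluding𝒲³,M[K₄] (n : ℕ) : Set₁ where
  field
    matroid  : Matroid n
    ground≡⊤ : ground matroid ≡ ⊤
    rank3    : HasRank matroid 3
    no-𝒲³    : ¬ HasMinor matroid 𝒲³
    no-M[K₄] : ¬ HasMinor matroid M[K₄]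

open Rank3Excluding𝒲³,M[K₄] using (matroid)

-- Labelled matroids: two are the same when they have the same independent sets.
rank3Excluding𝒲³,M[K₄] : ℕ → Setoid _ _
rank3Excluding𝒲³,M[K₄] n = record
  { Carrier = Rank3Excluding𝒲³,M[K₄] n
  ; _≈_     = λ M N → ∀ X → Indep (matroid M) X ⇔ Indep (matroid N) X
  ; isEquivalence = record
    { refl  = λ X → mk⇔ id id
    ; sym   = λ p X → mk⇔ (Equivalence.from (p X)) (Equivalence.to (p X))
    ; trans = λ p q X → mk⇔ (Equivalence.to (q X) ∘ Equivalence.to (p X))
                            (Equivalence.from (p X) ∘ Equivalence.from (q X))
    }
  }

HasCardinality : ∀ {s t} → Setoid s t → ℕ → Set _
HasCardinality S k = Inverse (setoid (Fin k)) S

-- g = 2^h for some h = o(s), i.e. for each rational ε = p / q > 0 eventually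
-- 0 < g i and |log₂ (g i)| ≤ ε · s i.  As g is ℕ-valued, log₂ (g i) ≥ 0 once g i > 0,
-- so only the upper bound on log₂ (g i) remains.
Is2^o[_] : (ℕ → ℕ) → (ℕ → ℕ) → Set
Is2^o[ s ] g = ∀ p q → .{{NonZero p}} → .{{NonZero q}} →
  ∃[ N ] ∀ i → N ≤ i → 0 < g i × g i ^ q ≤ 2 ^ (p * s i)

{-# OPTIONS --safe #-}
module Submission where

{- Three noncollinear points whose three connecting lines all carry a further point span a 𝒲³ or
   M(K₄), so in a matroid of the class any three points that are pairwise joined by long lines are
   collinear.  Sort each long line of the simplification.  The triples of consecutive points on
   lines then form a tripartite 3-graph in which two vertices determine the third and every
   triangle of the shadow is one of the triples, so by Ruzsa and Szemerédi there are o(n²) of them.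
   They determine all lines, and are themselves determined by their three projections to pairs.
   Together with the map of nonloops to representatives of parallel classes this encodes the
   matroid by 4n² bits only o(n²) of which are set, and there are 2^o(n²) such strings.

   For Ruzsa–Szemerédi, let A and B be the sets of the second and third coordinates of the triples
   through x.  The bipartite graph H of all last two coordinates is a matching between A and B.
   Given partitions of the two sides, all but few edges of H lie in a cell (P , Q) that is dense in H
   and for which some x has A ∩ P and B ∩ Q large, so that (P , Q) contains a large sparse block.
   Refining by one such pair A, B for each cell therefore increases the sum of the energies
   max(0, D e(P,Q) - |P||Q|) by a constant fraction of n².  This energy is superadditive under
   refinement and bounded by D n², hence a bounded number of steps leads to a contradiction. -}

open import Defs
open import Data.Bool using (Bool; true; false)
import Data.Bool.Properties as Bool
open import Data.Fin as Fin using (Fin; zero; suc; toℕ; #_)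
open import Data.Fin.Properties as Finₚ using (any?; injective⇒≤)
  renaming (<-cmp to <ᶠ-cmp; _<?_ to _<ᶠ?_; <⇒≢ to <ᶠ⇒≢)
open import Data.Fin.Subset
open import Data.Fin.Subset.Properties
open import Data.List
  using (List; []; _∷_; _++_; map; concatMap; length; lookup; filter; deduplicate; allFin; cartesianProduct)
import Data.List.Membership.DecPropositional as DecMembership
open import Data.List.Membership.Propositional using (lose) renaming (_∈_ to _∈ₗ_)
open import Data.List.Membership.Propositional.Properties
  using (∈-map⁺; ∈-map⁻; ∈-concatMap⁺; ∈-++⁺ˡ; ∈-++⁺ʳ; ∈-lookup; ∈-allFin; ∈-cartesianProduct⁺; ∈-filter⁺; ∈-filter⁻)
import Data.List.Membership.Setoid as SetoidMembership
import Data.List.Membership.Setoid.Properties as SetoidMembershipₚ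
open import Data.List.Properties using (map-∘; map-++; length-++; length-map; length-tabulate; ∷-injective)
open import Data.List.Relation.Binary.Permutation.Propositional
  using (_↭_; prep; swap; ↭-sym; ↭⇒↭ₛ) renaming (refl to ↭-refl)
open import Data.List.Relation.Binary.Permutation.Propositional.Properties using (∈-resp-↭)
open import Data.List.Relation.Binary.Permutation.Setoid.Properties using (Unique-resp-↭)
open import Data.List.Relation.Unary.All as All using (All; []; _∷_)
open import Data.List.Relation.Unary.All.Properties using (All¬⇒¬Any; ¬Any⇒All¬; ++⁺)
open import Data.List.Relation.Unary.AllPairs using ([]; _∷_; allPairs?)
open import Data.List.Relation.Unary.Any as Any using (Any; here; there)
open import Data.List.Relation.Unary.Any.Properties using (lookup-result; lookup-index; concatMap⁺)
open import Data.List.Relation.Unary.Unique.DecSetoid.Properties using (deduplicate-!)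
open import Data.List.Relation.Unary.Unique.Propositional using (Unique)
import Data.List.Relation.Unary.Unique.Propositional.Properties as Uniqueₚ
import Data.List.Relation.Unary.Unique.Setoid as SetoidUnique
open import Data.Maybe using (Maybe; just; nothing)
open import Data.Nat
  using (ℕ; zero; suc; _+_; _*_; _∸_; _^_; _/_; _⊔_; _≤_; _<_; z≤n; s≤s; NonZero; _≟_; _≤?_; _<?_)
open import Data.Nat.DivMod using (m/n*n≤m; /-monoˡ-≤; m*n/n≡m)
open import Data.Nat.ListAction using (sum)
open import Data.Nat.ListAction.Properties using (sum-++)
open import Data.Nat.Properties hiding (_≟_; _≤?_; _<?_; suc-injective)
open import Data.Nat.Tactic.RingSolver using (solve-∀)
open import Data.Product using (∃-syntax; _×_; _,_; proj₁; proj₂)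
open import Data.Sum using (_⊎_; inj₁; inj₂; [_,_]′)
open import Data.Vec as Vec using (Vec; []; _∷_; here; there)
open import Data.Vec.Properties using (≡-dec)
open import Data.Vec.Properties.WithK using ([]=-irrelevant)
open import Data.Vec.Relation.Unary.All using ([]; _∷_)
open import Data.Vec.Relation.Unary.AllPairs using ([]; _∷_)
open import Data.Vec.Relation.Unary.Unique.Propositional using () renaming (Unique to VecUnique)
open import Data.Vec.Relation.Unary.Unique.Propositional.Properties using () renaming (lookup-injective to Vec-lookup-injective)
open import Function using (_∘_; id; case_of_)
open import Function.Bundles using (_⇔_; mk⇔; Equivalence; Inverse; mk↔ₛ′)
open import Level using (Level)
open import Relation.Binary.Bundles using (Setoid; DecSetoid)
open import Relation.Binary.Definitions using (tri<; tri≈; tri>)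
open import Relation.Binary.PropositionalEquality
  using (_≡_; _≢_; refl; sym; ≢-sym; trans; cong; cong₂; subst; subst₂; setoid; module ≡-Reasoning)
open import Relation.Nullary using (¬_; Dec; yes; no; does; ¬?; contradiction)
open import Relation.Nullary.Decidable using (_×-dec_; _→-dec_; map′; decidable-stable; from-yes)
open import Relation.Unary using (Decidable)

private
  variable
    ℓ₁ ℓ₂ : Level
    A B : Set
    k n : ℕ

-- Sums

-- Opaque, so that unification may treat ∑ as injective.
opaque
  ∑ : ∀ {a} {A : Set a} → List A → (A → ℕ) → ℕ
  ∑ xs f = sum (map f xs)

infix 5 ∑
syntax ∑ xs (λ x → e) = ∑[ x ∈ xs ] e

opaque
  unfolding ∑

  ∑-[] : (f : A → ℕ) → ∑ [] f ≡ 0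
  ∑-[] f = refl

  ∑-∷ : (x : A) (xs : List A) (f : A → ℕ) → ∑ (x ∷ xs) f ≡ f x + ∑ xs f
  ∑-∷ x xs f = refl

  ∑-single : (x : A) (f : A → ℕ) → ∑ (x ∷ []) f ≡ f x
  ∑-single x f = +-identityʳ (f x)

  ∑-mono-∈ : {f g : A → ℕ} (xs : List A) → (∀ {x} → x ∈ₗ xs → f x ≤ g x) → ∑ xs f ≤ ∑ xs g
  ∑-mono-∈ []       f≤g = z≤n
  ∑-mono-∈ (x ∷ xs) f≤g = +-mono-≤ (f≤g (here refl)) (∑-mono-∈ xs (λ i → f≤g (there i)))

  ∑-mono : {f g : A → ℕ} (xs : List A) → (∀ x → f x ≤ g x) → ∑ xs f ≤ ∑ xs g
  ∑-mono xs f≤g = ∑-mono-∈ xs (λ {x} _ → f≤g x)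

  ∑-cong : {f g : A → ℕ} (xs : List A) → (∀ x → f x ≡ g x) → ∑ xs f ≡ ∑ xs g
  ∑-cong []       f≡g = refl
  ∑-cong (x ∷ xs) f≡g = cong₂ _+_ (f≡g x) (∑-cong xs f≡g)

  ∑-+ : (xs : List A) (f g : A → ℕ) → ∑[ x ∈ xs ] (f x + g x) ≡ ∑ xs f + ∑ xs g
  ∑-+ []       f g = refl
  ∑-+ (x ∷ xs) f g = trans (cong (f x + g x +_) (∑-+ xs f g)) (interchange (f x) (g x) _ _)
    where
    interchange : ∀ a b c d → a + b + (c + d) ≡ a + c + (b + d)
    interchange = solve-∀

  ∑-*ˡ : (c : ℕ) (xs : List A) (f : A → ℕ) → ∑[ x ∈ xs ] (c * f x) ≡ c * ∑ xs f
  ∑-*ˡ c []       f = sym (*-zeroʳ c)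
  ∑-*ˡ c (x ∷ xs) f = trans (cong (c * f x +_) (∑-*ˡ c xs f)) (sym (*-distribˡ-+ c (f x) _))

  ∑-*ʳ : (xs : List A) (f : A → ℕ) (c : ℕ) → ∑[ x ∈ xs ] (f x * c) ≡ ∑ xs f * c
  ∑-*ʳ xs f c = trans (∑-cong xs (λ x → *-comm (f x) c)) (trans (∑-*ˡ c xs f) (*-comm c _))

  ∑-const : (xs : List A) (c : ℕ) → ∑[ _ ∈ xs ] c ≡ length xs * c
  ∑-const []       c = refl
  ∑-const (x ∷ xs) c = cong (c +_) (∑-const xs c)

  ∑-swap : (xs : List A) (ys : List B) (h : A → B → ℕ) →
    ∑[ x ∈ xs ] ∑[ y ∈ ys ] h x y ≡ ∑[ y ∈ ys ] ∑[ x ∈ xs ] h x y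
  ∑-swap []       ys h = sym (trans (∑-const ys 0) (*-zeroʳ (length ys)))
  ∑-swap (x ∷ xs) ys h =
    trans (cong (∑ ys (h x) +_) (∑-swap xs ys h)) (sym (∑-+ ys (h x) _))

  ∑-++ : (xs ys : List A) (f : A → ℕ) → ∑ (xs ++ ys) f ≡ ∑ xs f + ∑ ys f
  ∑-++ xs ys f = trans (cong sum (map-++ f xs ys)) (sum-++ (map f xs) (map f ys))

  ∑-map : (h : A → B) (xs : List A) (f : B → ℕ) → ∑ (map h xs) f ≡ ∑[ x ∈ xs ] f (h x)
  ∑-map h xs f = cong sum (sym (map-∘ xs))

  ∑-concatMap : (h : A → List B) (xs : List A) (f : B → ℕ) →
    ∑ (concatMap h xs) f ≡ ∑[ x ∈ xs ] ∑ (h x) f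
  ∑-concatMap h []       f = refl
  ∑-concatMap h (x ∷ xs) f =
    trans (∑-++ (h x) (concatMap h xs) f) (cong (∑ (h x) f +_) (∑-concatMap h xs f))

  ∑-cartesianProduct : (xs : List A) (ys : List B) (f : A × B → ℕ) →
    ∑ (cartesianProduct xs ys) f ≡ ∑[ x ∈ xs ] ∑[ y ∈ ys ] f (x , y)
  ∑-cartesianProduct []       ys f = refl
  ∑-cartesianProduct (x ∷ xs) ys f =
    trans (∑-++ (map (x ,_) ys) _ f) (cong₂ _+_ (∑-map (x ,_) ys f) (∑-cartesianProduct xs ys f))

  ∈⇒≤∑ : {x : A} {xs : List A} (f : A → ℕ) → x ∈ₗ xs → f x ≤ ∑ xs f
  ∈⇒≤∑ f (here refl) = m≤m+n _ _
  ∈⇒≤∑ f (there i)   = ≤-trans (∈⇒≤∑ f i) (m≤n+m _ _)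

𝟙 : {P : Set} → Dec P → ℕ
𝟙 (yes _) = 1
𝟙 (no  _) = 0

𝟙-yes : {P : Set} (d : Dec P) → P → 𝟙 d ≡ 1
𝟙-yes (yes _) p = refl
𝟙-yes (no ¬p) p = contradiction p ¬p

-- Refinements of partitions

infixl 7 _∙_

_∙_ : (A → ℕ) → (A → ℕ) → A → ℕ
(P ∙ a) y = P y * a y

co : (A → ℕ) → A → ℕ
co a y = 1 ∸ a y

-- Parts are represented by their indicator functions.
refine : List (A → ℕ) → (A → ℕ) → List (A → ℕ)
refine []       P = P ∷ []
refine (a ∷ as) P = refine as (P ∙ a) ++ refine as (P ∙ co a)

≤1-All : List (A → ℕ) → Set
≤1-All {A} as = ∀ {a} → a ∈ₗ as → (y : A) → a y ≤ 1

split-+ : {a : A → ℕ} (P : A → ℕ) → (∀ y → a y ≤ 1) → ∀ y → (P ∙ a) y + (P ∙ co a) y ≡ P y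
split-+ {a = a} P a≤1 y = trans (sym (*-distribˡ-+ (P y) (a y) _))
  (trans (cong (P y *_) (m+[n∸m]≡n (a≤1 y))) (*-identityʳ (P y)))

length-refine : (as : List (A → ℕ)) (P : A → ℕ) → length (refine as P) ≡ 2 ^ length as
length-refine []       P = refl
length-refine (a ∷ as) P = trans (length-++ (refine as (P ∙ a)))
  (cong₂ _+_ (length-refine as _) (trans (length-refine as _) (sym (+-identityʳ _))))

∑-refine : (as : List (A → ℕ)) → ≤1-All as → (P : A → ℕ) → ∀ y → ∑[ P′ ∈ refine as P ] P′ y ≡ P y
∑-refine []       as≤1 P y = ∑-single P _
∑-refine (a ∷ as) as≤1 P y = trans (∑-++ (refine as (P ∙ a)) _ _)
  (trans (cong₂ _+_ (∑-refine as (λ i → as≤1 (there i)) _ y) (∑-refine as (λ i → as≤1 (there i)) _ y))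
         (split-+ P (as≤1 (here refl)) y))

-- `ext` stands in for function extensionality: splitting by the same indicators in another order
-- gives parts that are only pointwise equal.
record Superadditive (F : (A → ℕ) → ℕ) : Set where
  field
    ext   : ∀ {P P′} → (∀ y → P y ≡ P′ y) → F P ≡ F P′
    split : ∀ P {a} → (∀ y → a y ≤ 1) → F P ≤ F (P ∙ a) + F (P ∙ co a)

  refine-≤ : ∀ as → ≤1-All as → ∀ P → F P ≤ ∑ (refine as P) F
  refine-≤ []       as≤1 P = ≤-reflexive (sym (∑-single P F))
  refine-≤ (a ∷ as) as≤1 P = begin
    F P                                                      ≤⟨ split P (as≤1 (here refl)) ⟩
    F (P ∙ a) + F (P ∙ co a)                                 ≤⟨ +-mono-≤ (refine-≤ as (λ i → as≤1 (there i)) _)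
                                                                         (refine-≤ as (λ i → as≤1 (there i)) _) ⟩
    ∑ (refine as (P ∙ a)) F + ∑ (refine as (P ∙ co a)) F     ≡⟨ ∑-++ (refine as (P ∙ a)) _ F ⟨
    ∑ (refine (a ∷ as) P) F                                  ∎
    where open ≤-Reasoning

  -- If `a` is not the head `b`, split both halves by `b` as well, exchange the order of the two
  -- splits by `ext`, and apply induction to the two halves of `P` made by `b`.
  split-≤-refine : ∀ as → ≤1-All as → ∀ P {a} → a ∈ₗ as → F (P ∙ a) + F (P ∙ co a) ≤ ∑ (refine as P) F
  split-≤-refine (a ∷ as) as≤1 P (here refl) =
    ≤-trans (+-mono-≤ (refine-≤ as (λ i → as≤1 (there i)) _) (refine-≤ as (λ i → as≤1 (there i)) _))
            (≤-reflexive (sym (∑-++ (refine as (P ∙ a)) _ F)))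
  split-≤-refine (b ∷ as) as≤1 P {a} (there i) = begin
    F (P ∙ a) + F (P ∙ co a)
      ≤⟨ +-mono-≤ (split _ (as≤1 (here refl))) (split _ (as≤1 (here refl))) ⟩
    (F (P ∙ a ∙ b) + F (P ∙ a ∙ co b)) + (F (P ∙ co a ∙ b) + F (P ∙ co a ∙ co b))
      ≡⟨ cong₂ _+_ (cong₂ _+_ (∙-swap a b) (∙-swap a (co b))) (cong₂ _+_ (∙-swap (co a) b) (∙-swap (co a) (co b))) ⟩
    (F (P ∙ b ∙ a) + F (P ∙ co b ∙ a)) + (F (P ∙ b ∙ co a) + F (P ∙ co b ∙ co a))
      ≡⟨ interchange (F (P ∙ b ∙ a)) _ _ _ ⟩
    (F (P ∙ b ∙ a) + F (P ∙ b ∙ co a)) + (F (P ∙ co b ∙ a) + F (P ∙ co b ∙ co a))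
      ≤⟨ +-mono-≤ (split-≤-refine as (λ i → as≤1 (there i)) _ i) (split-≤-refine as (λ i → as≤1 (there i)) _ i) ⟩
    ∑ (refine as (P ∙ b)) F + ∑ (refine as (P ∙ co b)) F
      ≡⟨ ∑-++ (refine as (P ∙ b)) _ F ⟨
    ∑ (refine (b ∷ as) P) F ∎
    where
    open ≤-Reasoning
    ∙-swap : ∀ c d → F (P ∙ c ∙ d) ≡ F (P ∙ d ∙ c)
    ∙-swap c d = ext (λ y → comm (P y) (c y) (d y))
      where
      comm : ∀ p q r → p * q * r ≡ p * r * q
      comm = solve-∀
    interchange : ∀ p q r s → (p + q) + (r + s) ≡ (p + r) + (q + s)
    interchange = solve-∀

∑-superadditive : {B : Set} (bs : List B) {F : B → (A → ℕ) → ℕ} →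
  (∀ b → Superadditive (F b)) → Superadditive (λ P → ∑[ b ∈ bs ] F b P)
∑-superadditive bs {F} sup = record
  { ext   = λ P≡ → ∑-cong bs (λ b → Superadditive.ext (sup b) P≡)
  ; split = λ P a≤1 → ≤-trans (∑-mono bs (λ b → Superadditive.split (sup b) P a≤1))
                              (≤-reflexive (∑-+ bs _ _))
  }

-- Truncating the two differences separately replaces negative summands by 0 and so can only raise
-- the sum.
∸-superadditive : ∀ a b c d → (a + b) ∸ (c + d) ≤ (a ∸ c) + (b ∸ d)
∸-superadditive a b c d = m≤n+o⇒m∸n≤o (a + b) (c + d)
  (≤-trans (+-mono-≤ (m≤n+m∸n a c) (m≤n+m∸n b d)) (≤-reflexive (interchange c (a ∸ c) d (b ∸ d))))
  where
  interchange : ∀ p q r s → (p + q) + (r + s) ≡ (p + r) + (q + s)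
  interchange = solve-∀

partition : List (A → ℕ) → Set
partition {A} 𝒫 = (y : A) → ∑[ P ∈ 𝒫 ] P y ≡ 1

refine-partition : (as : List (A → ℕ)) → ≤1-All as → {𝒫 : List (A → ℕ)} →
  partition 𝒫 → partition (concatMap (refine as) 𝒫)
refine-partition as as≤1 {𝒫} part y =
  trans (∑-concatMap (refine as) 𝒫 _) (trans (∑-cong 𝒫 (λ P → ∑-refine as as≤1 P y)) (part y))

length-concatMap : {B : Set} (h : A → List B) {k : ℕ} → (∀ x → length (h x) ≤ k) →
  (xs : List A) → length (concatMap h xs) ≤ length xs * k
length-concatMap h bound []       = z≤n
length-concatMap h bound (x ∷ xs) =
  ≤-trans (≤-reflexive (length-++ (h x))) (+-mono-≤ (bound x) (length-concatMap h bound xs))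

-- Energy of a pair of parts

module _ {X Y Z : Set} (xs : List X) (ys : List Y) (zs : List Z) where

  ∬ : (Y → Z → ℕ) → ℕ
  ∬ h = ∑[ y ∈ ys ] ∑[ z ∈ zs ] h y z

  private
    variable
      h h₁ h₂ : Y → Z → ℕ

  ∬-cong : (∀ y z → h y z ≡ h₁ y z) → ∬ h ≡ ∬ h₁
  ∬-cong eq = ∑-cong ys (λ y → ∑-cong zs (eq y))

  ∬-mono : (∀ y z → h y z ≤ h₁ y z) → ∬ h ≤ ∬ h₁
  ∬-mono le = ∑-mono ys (λ y → ∑-mono zs (le y))

  ∬-+ : (∀ y z → h y z ≡ h₁ y z + h₂ y z) → ∬ h ≡ ∬ h₁ + ∬ h₂
  ∬-+ eq = trans (∑-cong ys (λ y → trans (∑-cong zs (eq y)) (∑-+ zs _ _))) (∑-+ ys _ _)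

  -- For indicators `P`, `Q` and a bipartite graph `f` this is the number e(P, Q) of edges between
  -- the two parts.
  ⟨_,_⟩ : (Y → ℕ) → (Z → ℕ) → (Y → Z → ℕ) → ℕ
  ⟨ P , Q ⟩ f = ∬ (λ y z → P y * Q z * f y z)

  area : (Y → ℕ) → (Z → ℕ) → ℕ
  area P Q = ∑ ys P * ∑ zs Q

  ⟨⟩-splitˡ : ∀ P Q f {a : Y → ℕ} → (∀ y → a y ≤ 1) → ⟨ P , Q ⟩ f ≡ ⟨ P ∙ a , Q ⟩ f + ⟨ P ∙ co a , Q ⟩ f
  ⟨⟩-splitˡ P Q f {a} a≤1 = ∬-+ λ y z →
    trans (cong (λ p → p * Q z * f y z) (sym (split-+ P a≤1 y))) (distrib ((P ∙ a) y) _ (Q z) (f y z))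
    where
    distrib : ∀ p p′ q r → (p + p′) * q * r ≡ p * q * r + p′ * q * r
    distrib = solve-∀

  ⟨⟩-splitʳ : ∀ P Q f {b : Z → ℕ} → (∀ z → b z ≤ 1) → ⟨ P , Q ⟩ f ≡ ⟨ P , Q ∙ b ⟩ f + ⟨ P , Q ∙ co b ⟩ f
  ⟨⟩-splitʳ P Q f {b} b≤1 = ∬-+ λ y z →
    trans (cong (λ q → P y * q * f y z) (sym (split-+ Q b≤1 z))) (distrib (P y) ((Q ∙ b) z) _ (f y z))
    where
    distrib : ∀ p q q′ r → p * (q + q′) * r ≡ p * q * r + p * q′ * r
    distrib = solve-∀

  ∑-split : {A : Set} (as : List A) (P : A → ℕ) {a : A → ℕ} → (∀ y → a y ≤ 1) → ∑ as P ≡ ∑ as (P ∙ a) + ∑ as (P ∙ co a)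
  ∑-split as P a≤1 = trans (∑-cong as (λ y → sym (split-+ P a≤1 y))) (∑-+ as _ _)

  area-splitˡ : ∀ P Q {a : Y → ℕ} → (∀ y → a y ≤ 1) → area P Q ≡ area (P ∙ a) Q + area (P ∙ co a) Q
  area-splitˡ P Q a≤1 = trans (cong (_* ∑ zs Q) (∑-split ys P a≤1)) (*-distribʳ-+ (∑ zs Q) (∑ ys (P ∙ _)) _)

  area-splitʳ : ∀ P Q {b : Z → ℕ} → (∀ z → b z ≤ 1) → area P Q ≡ area P (Q ∙ b) + area P (Q ∙ co b)
  area-splitʳ P Q b≤1 = trans (cong (∑ ys P *_) (∑-split zs Q b≤1)) (*-distribˡ-+ (∑ ys P) _ _)

  ∬-product : ∀ P Q → ∬ (λ y z → P y * Q z) ≡ area P Q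
  ∬-product P Q = trans (∑-cong ys (λ y → ∑-*ˡ (P y) zs Q)) (∑-*ʳ ys P _)

  module Energy (H : Y → Z → ℕ) (D : ℕ) where

    -- Takes the place of the usual quadratic energy of a cell: the truncated subtraction makes it
    -- superadditive and lets a sparse block inside a dense cell increase it.
    Ψ : (Y → ℕ) → (Z → ℕ) → ℕ
    Ψ P Q = D * ⟨ P , Q ⟩ H ∸ area P Q

    Ψ-superadditiveˡ : ∀ Q → Superadditive (λ P → Ψ P Q)
    Ψ-superadditiveˡ Q = record
      { ext   = λ P≡ → cong₂ (λ e p → D * e ∸ p * ∑ zs Q)
                  (∬-cong (λ y z → cong (λ p → p * Q z * H y z) (P≡ y))) (∑-cong ys P≡)
      ; split = λ P {a} a≤1 → ≤-trans
          (≤-reflexive (cong₂ _∸_ (trans (cong (D *_) (⟨⟩-splitˡ P Q H a≤1)) (*-distribˡ-+ D _ _))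
                                  (area-splitˡ P Q a≤1)))
          (∸-superadditive (D * ⟨ P ∙ a , Q ⟩ H) _ (area (P ∙ a) Q) _)
      }

    Ψ-superadditiveʳ : ∀ P → Superadditive (Ψ P)
    Ψ-superadditiveʳ P = record
      { ext   = λ Q≡ → cong₂ (λ e q → D * e ∸ ∑ ys P * q)
                  (∬-cong (λ y z → cong (λ q → P y * q * H y z) (Q≡ z))) (∑-cong zs Q≡)
      ; split = λ Q {b} b≤1 → ≤-trans
          (≤-reflexive (cong₂ _∸_ (trans (cong (D *_) (⟨⟩-splitʳ P Q H b≤1)) (*-distribˡ-+ D _ _))
                                  (area-splitʳ P Q b≤1)))
          (∸-superadditive (D * ⟨ P , Q ∙ b ⟩ H) _ (area P (Q ∙ b)) _)
      }

    module Refine {as : List (Y → ℕ)} {bs : List (Z → ℕ)} (as≤1 : ≤1-All as) (bs≤1 : ≤1-All bs) where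

      Ψ′ : (Y → ℕ) → (Z → ℕ) → ℕ
      Ψ′ P Q = ∑[ P′ ∈ refine as P ] ∑[ Q′ ∈ refine bs Q ] Ψ P′ Q′

      private
        inner : ∀ Q → Superadditive (λ P → ∑[ Q′ ∈ refine bs Q ] Ψ P Q′)
        inner Q = ∑-superadditive (refine bs Q) Ψ-superadditiveˡ

      Ψ≤Ψ′ : ∀ P Q → Ψ P Q ≤ Ψ′ P Q
      Ψ≤Ψ′ P Q = ≤-trans (Superadditive.refine-≤ (Ψ-superadditiveʳ P) bs bs≤1 Q)
                         (Superadditive.refine-≤ (inner Q) as as≤1 P)

      four≤Ψ′ : ∀ P Q {a b} → a ∈ₗ as → b ∈ₗ bs →
        (Ψ (P ∙ a) (Q ∙ b) + Ψ (P ∙ a) (Q ∙ co b)) + (Ψ (P ∙ co a) (Q ∙ b) + Ψ (P ∙ co a) (Q ∙ co b)) ≤ Ψ′ P Q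
      four≤Ψ′ P Q a∈ b∈ = ≤-trans
        (+-mono-≤ (Superadditive.split-≤-refine (Ψ-superadditiveʳ _) bs bs≤1 Q b∈)
                  (Superadditive.split-≤-refine (Ψ-superadditiveʳ _) bs bs≤1 Q b∈))
        (Superadditive.split-≤-refine (inner Q) as as≤1 P a∈)

      -- In a dense cell the truncation in `Ψ P Q` has no effect, so `Ψ P Q` is the sum of the
      -- untruncated energies of the four blocks. That of the sparse block is at most minus half its
      -- area. Counting it as 0 in the refinement gains this half; the factor 2 avoids the fraction.
      gain : ∀ P Q {a b} → a ∈ₗ as → b ∈ₗ bs →
        area P Q ≤ D * ⟨ P , Q ⟩ H → 2 * (D * ⟨ P ∙ a , Q ∙ b ⟩ H) ≤ area (P ∙ a) (Q ∙ b) →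
        2 * Ψ P Q + area (P ∙ a) (Q ∙ b) ≤ 2 * Ψ′ P Q
      gain P Q {a} {b} a∈ b∈ dense sparse = +-cancelʳ-≤ (2 * s) _ _ (begin
        2 * Ψ P Q + s₁ + 2 * s                      ≡⟨ regroup (Ψ P Q) s₁ s ⟩
        2 * (s + Ψ P Q) + s₁                        ≡⟨ cong (λ w → 2 * w + s₁) (m+[n∸m]≡n dense) ⟩
        2 * (D * e) + s₁                            ≡⟨ cong (λ w → 2 * w + s₁) e-four ⟩
        2 * (De₁ + De₂ + (De₃ + De₄)) + s₁          ≡⟨ regroup₂ De₁ De₂ De₃ De₄ s₁ ⟩
        2 * De₁ + (s₁ + 2 * (De₂ + De₃ + De₄))      ≤⟨ +-mono-≤ sparse (+-monoʳ-≤ s₁ (*-monoʳ-≤ 2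
                                                        (+-mono-≤ (+-mono-≤ (m≤n+m∸n De₂ s₂) (m≤n+m∸n De₃ s₃)) (m≤n+m∸n De₄ s₄)))) ⟩
        s₁ + (s₁ + 2 * (s₂ + Ψ₂ + (s₃ + Ψ₃) + (s₄ + Ψ₄)))
                                                    ≡⟨ regroup₃ s₁ s₂ s₃ s₄ Ψ₂ Ψ₃ Ψ₄ ⟩
        2 * (Ψ₂ + (Ψ₃ + Ψ₄)) + 2 * (s₁ + s₂ + (s₃ + s₄))
                                                    ≤⟨ +-monoˡ-≤ _ (*-monoʳ-≤ 2 (≤-trans (+-monoˡ-≤ _ (m≤n+m Ψ₂ (Ψ (P ∙ a) (Q ∙ b)))) (four≤Ψ′ P Q a∈ b∈))) ⟩
        2 * Ψ′ P Q + 2 * (s₁ + s₂ + (s₃ + s₄))      ≡⟨ cong (λ w → 2 * Ψ′ P Q + 2 * w) s-four ⟨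
        2 * Ψ′ P Q + 2 * s                          ∎)
        where
        open ≤-Reasoning
        a≤1 = as≤1 a∈
        b≤1 = bs≤1 b∈
        e = ⟨ P , Q ⟩ H
        s = area P Q
        De₁ = D * ⟨ P ∙ a , Q ∙ b ⟩ H
        De₂ = D * ⟨ P ∙ a , Q ∙ co b ⟩ H
        De₃ = D * ⟨ P ∙ co a , Q ∙ b ⟩ H
        De₄ = D * ⟨ P ∙ co a , Q ∙ co b ⟩ H
        s₁ = area (P ∙ a) (Q ∙ b)
        s₂ = area (P ∙ a) (Q ∙ co b)
        s₃ = area (P ∙ co a) (Q ∙ b)
        s₄ = area (P ∙ co a) (Q ∙ co b)
        Ψ₂ = Ψ (P ∙ a) (Q ∙ co b)
        Ψ₃ = Ψ (P ∙ co a) (Q ∙ b)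
        Ψ₄ = Ψ (P ∙ co a) (Q ∙ co b)

        e-four : D * e ≡ De₁ + De₂ + (De₃ + De₄)
        e-four = trans (cong (D *_) (trans (⟨⟩-splitˡ P Q H a≤1)
            (cong₂ _+_ (⟨⟩-splitʳ (P ∙ a) Q H b≤1) (⟨⟩-splitʳ (P ∙ co a) Q H b≤1))))
          (distrib D (⟨ P ∙ a , Q ∙ b ⟩ H) _ (⟨ P ∙ co a , Q ∙ b ⟩ H) _)
          where
          distrib : ∀ d p q r s → d * ((p + q) + (r + s)) ≡ d * p + d * q + (d * r + d * s)
          distrib = solve-∀

        s-four : s ≡ s₁ + s₂ + (s₃ + s₄)
        s-four = trans (area-splitˡ P Q a≤1)
          (cong₂ _+_ (area-splitʳ (P ∙ a) Q b≤1) (area-splitʳ (P ∙ co a) Q b≤1))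

        regroup : ∀ p q r → 2 * p + q + 2 * r ≡ 2 * (r + p) + q
        regroup = solve-∀
        regroup₂ : ∀ p q r s t → 2 * (p + q + (r + s)) + t ≡ 2 * p + (t + 2 * (q + r + s))
        regroup₂ = solve-∀
        regroup₃ : ∀ p q r s t u v →
          p + (p + 2 * (q + t + (r + u) + (s + v))) ≡ 2 * (t + (u + v)) + 2 * (p + q + (r + s))
        regroup₃ = solve-∀

-- Triple systems and the gain in one cell

∑-swap₃ : {A B C : Set} (as : List A) (bs : List B) (cs : List C) (h : A → B → C → ℕ) →
  ∑[ a ∈ as ] ∑[ b ∈ bs ] ∑[ c ∈ cs ] h a b c ≡ ∑[ c ∈ cs ] ∑[ a ∈ as ] ∑[ b ∈ bs ] h a b c
∑-swap₃ as bs cs h = trans (∑-cong as (λ a → ∑-swap bs cs (h a))) (∑-swap as cs _)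

module TripleSystem {X Y Z : Set} (xs : List X) (ys : List Y) (zs : List Z) (t : X → Y → Z → ℕ) where

  -- Under `Linear∧TriangleClosed` the three functions have values 0 and 1. Then `XY x` and `XZ x`
  -- are the indicators of the sets A and B belonging to `x`, and `YZ` is the graph H.
  XY : X → Y → ℕ
  XY x y = ∑[ z ∈ zs ] t x y z

  XZ : X → Z → ℕ
  XZ x z = ∑[ y ∈ ys ] t x y z

  YZ : Y → Z → ℕ
  YZ y z = ∑[ x ∈ xs ] t x y z

  size : ℕ
  size = ∑[ x ∈ xs ] ∑[ y ∈ ys ] ∑[ z ∈ zs ] t x y z

  -- `closed` says that every triangle of the tripartite graph formed by the triples is one of them.
  record Linear∧TriangleClosed : Set where
    field
      XY≤1   : ∀ x y → XY x y ≤ 1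
      XZ≤1   : ∀ x z → XZ x z ≤ 1
      YZ≤1   : ∀ y z → YZ y z ≤ 1
      closed : ∀ x y z → XY x y * XZ x z * YZ y z ≤ t x y z

  module _ (hyp : Linear∧TriangleClosed) (D : ℕ) where
    open Linear∧TriangleClosed hyp
    open Energy xs ys zs YZ D using (Ψ; module Refine)

    ⟪_,_⟫ = ⟨_,_⟩ xs ys zs
    ar = area xs ys zs

    -- Sorts the edges of H in the cell by the vertex `x` that completes them to a triple, as `e≡∑τ`
    -- shows.
    τ : X → (Y → ℕ) → (Z → ℕ) → ℕ
    τ x P Q = ⟪ P , Q ⟫ (t x)

    e≡∑τ : ∀ P Q → ⟪ P , Q ⟫ YZ ≡ ∑[ x ∈ xs ] τ x P Q
    e≡∑τ P Q = trans
      (∑-cong ys (λ y → ∑-cong zs (λ z → sym (∑-*ˡ (P y * Q z) xs (λ x → t x y z)))))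
      (∑-swap₃ ys zs xs _)

    e≤area : ∀ P Q → ⟪ P , Q ⟫ YZ ≤ ar P Q
    e≤area P Q = ≤-trans
      (∬-mono xs ys zs (λ y z → ≤-trans (*-monoʳ-≤ (P y * Q z) (YZ≤1 y z)) (≤-reflexive (*-identityʳ _))))
      (≤-reflexive (∬-product xs ys zs P Q))

    ∬-Pt : ∀ x P → ∬ xs ys zs (λ y z → P y * t x y z) ≡ ∑ ys (P ∙ XY x)
    ∬-Pt x P = ∑-cong ys (λ y → ∑-*ˡ (P y) zs (t x y))

    ∬-Qt : ∀ x Q → ∬ xs ys zs (λ y z → Q z * t x y z) ≡ ∑ zs (Q ∙ XZ x)
    ∬-Qt x Q = trans (∑-swap ys zs _) (∑-cong zs (λ z → ∑-*ˡ (Q z) ys (λ y → t x y z)))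

    τ≤∑P : ∀ x P {Q} → (∀ z → Q z ≤ 1) → τ x P Q ≤ ∑ ys (P ∙ XY x)
    τ≤∑P x P Q≤1 = ≤-trans
      (∬-mono xs ys zs (λ y z → *-monoˡ-≤ (t x y z) {P y * _} {P y} (≤-trans (*-monoʳ-≤ (P y) (Q≤1 z)) (≤-reflexive (*-identityʳ (P y))))))
      (≤-reflexive (∬-Pt x P))

    -- An edge of H between A ∩ P and B ∩ Q closes a triangle with `x`, so by `closed` it comes from
    -- a triple through `x`. With `τ≤∑P` this leaves at most |A ∩ P| edges in the block.
    block≤τ : ∀ x P Q → ⟪ P ∙ XY x , Q ∙ XZ x ⟫ YZ ≤ τ x P Q
    block≤τ x P Q = ∬-mono xs ys zs (λ y z → ≤-trans
      (≤-reflexive (regroup (P y) (XY x y) (Q z) (XZ x z) (YZ y z)))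
      (*-monoʳ-≤ (P y * Q z) (closed x y z)))
      where
      regroup : ∀ p a q b h → p * a * (q * b) * h ≡ p * q * (a * b * h)
      regroup = solve-∀

    ∑-τˡ : ∀ x Q {𝒫} → partition 𝒫 → ∑[ P ∈ 𝒫 ] τ x P Q ≡ ∑ zs (Q ∙ XZ x)
    ∑-τˡ x Q {𝒫} part = begin
      ∑[ P ∈ 𝒫 ] τ x P Q                                                      ≡⟨ ∑-swap₃ ys zs 𝒫 _ ⟨
      ∑[ y ∈ ys ] ∑[ z ∈ zs ] ∑[ P ∈ 𝒫 ] (P y * Q z * t x y z)                ≡⟨ ∬-cong xs ys zs (λ y z → trans
            (∑-cong 𝒫 (λ P → *-assoc (P y) (Q z) (t x y z))) (trans (∑-*ʳ 𝒫 (λ P → P y) _)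
            (trans (cong (_* (Q z * t x y z)) (part y)) (*-identityˡ _)))) ⟩
      ∑[ y ∈ ys ] ∑[ z ∈ zs ] (Q z * t x y z)                                 ≡⟨ ∬-Qt x Q ⟩
      ∑ zs (Q ∙ XZ x)                                                         ∎
      where open ≡-Reasoning

    ∑-τʳ : ∀ x P {𝒬} → partition 𝒬 → ∑[ Q ∈ 𝒬 ] τ x P Q ≡ ∑ ys (P ∙ XY x)
    ∑-τʳ x P {𝒬} part = begin
      ∑[ Q ∈ 𝒬 ] τ x P Q                                                      ≡⟨ ∑-swap₃ ys zs 𝒬 _ ⟨
      ∑[ y ∈ ys ] ∑[ z ∈ zs ] ∑[ Q ∈ 𝒬 ] (P y * Q z * t x y z)                ≡⟨ ∬-cong xs ys zs (λ y z → trans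
            (∑-cong 𝒬 (λ Q → regroup (P y) (Q z) (t x y z))) (trans (∑-*ʳ 𝒬 (λ Q → Q z) _)
            (trans (cong (_* (P y * t x y z)) (part z)) (*-identityˡ _)))) ⟩
      ∑[ y ∈ ys ] ∑[ z ∈ zs ] (P y * t x y z)                                 ≡⟨ ∬-Pt x P ⟩
      ∑ ys (P ∙ XY x)                                                         ∎
      where
      open ≡-Reasoning
      regroup : ∀ p q r → p * q * r ≡ q * (p * r)
      regroup = solve-∀

    -- By the first two conditions the area of the cell is at most D² times that of the block (A ∩
    -- P, B ∩ Q). The third makes the block sparse: it has at most |A ∩ P| edges, but area at least
    -- 2D |A ∩ P|.
    Witness : (Y → ℕ) → (Z → ℕ) → X → Set
    Witness P Q x = ∑ ys P ≤ D * ∑ ys (P ∙ XY x) × ∑ zs Q ≤ D * ∑ zs (Q ∙ XZ x) × 2 * D ≤ ∑ zs (Q ∙ XZ x)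

    witness? : ∀ P Q x → Dec (Witness P Q x)
    witness? P Q x = (∑ ys P ≤? D * ∑ ys (P ∙ XY x)) ×-dec (∑ zs Q ≤? D * ∑ zs (Q ∙ XZ x)) ×-dec
                     (2 * D ≤? ∑ zs (Q ∙ XZ x))

    -- Each condition of `Witness` concerns only one of the two parts, so when it fails, the sum of
    -- `τ` over the parts of the other side can be evaluated. Hence one summand per condition.
    bad₁ bad₂ bad₃ : (Y → ℕ) → (Z → ℕ) → X → ℕ
    bad₁ P Q x = 𝟙 (D * ∑ ys (P ∙ XY x) <? ∑ ys P) * τ x P Q
    bad₂ P Q x = 𝟙 (D * ∑ zs (Q ∙ XZ x) <? ∑ zs Q) * τ x P Q
    bad₃ P Q x = 𝟙 (∑ zs (Q ∙ XZ x) <? 2 * D) * τ x P Q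

    bad : (Y → ℕ) → (Z → ℕ) → X → ℕ
    bad P Q x = bad₁ P Q x + bad₂ P Q x + bad₃ P Q x

    ¬witness⇒bad : ∀ P Q x → ¬ Witness P Q x → τ x P Q ≤ bad P Q x
    ¬witness⇒bad P Q x ¬w
      with D * ∑ ys (P ∙ XY x) <? ∑ ys P | D * ∑ zs (Q ∙ XZ x) <? ∑ zs Q | ∑ zs (Q ∙ XZ x) <? 2 * D
    ... | yes _ | _     | _     = ≤-trans (m≤m+n _ 0) (≤-trans (m≤m+n _ _) (m≤m+n _ _))
    ... | no _  | yes _ | _     = ≤-trans (m≤m+n _ 0) (m≤m+n _ _)
    ... | no _  | no _  | yes _ = m≤m+n _ 0
    ... | no p  | no q  | no r  = contradiction (≮⇒≥ p , ≮⇒≥ q , ≮⇒≥ r) ¬w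

    -- For a witness, D e(P,Q) ≤ D |P||Q| ≤ D³ |A ∩ P||B ∩ Q|, so `c` times the gain in `2 * Ψ` pays
    -- for `D` times the edges of the cell.
    c : ℕ
    c = D * (D * D)

    module _ {as : List (Y → ℕ)} {bs : List (Z → ℕ)} (as≤1 : ≤1-All as) (bs≤1 : ≤1-All bs) where
      open Refine as≤1 bs≤1

      witness⇒gain : ∀ P Q {x} → (∀ z → Q z ≤ 1) → Witness P Q x → XY x ∈ₗ as → XZ x ∈ₗ bs →
        ar P Q ≤ D * ⟪ P , Q ⟫ YZ → c * (2 * Ψ P Q) + D * ⟪ P , Q ⟫ YZ ≤ c * (2 * Ψ′ P Q)
      witness⇒gain P Q {x} Q≤1 (P≤ , Q≤ , large) a∈ b∈ dense = begin
        c * (2 * Ψ P Q) + D * ⟪ P , Q ⟫ YZ                   ≤⟨ +-monoʳ-≤ _ (*-monoʳ-≤ D (e≤area P Q)) ⟩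
        c * (2 * Ψ P Q) + D * ar P Q                         ≤⟨ +-monoʳ-≤ _ (*-monoʳ-≤ D (*-mono-≤ P≤ Q≤)) ⟩
        c * (2 * Ψ P Q) + D * (D * PA * (D * QB))            ≡⟨ regroup D (2 * Ψ P Q) PA QB ⟩
        c * (2 * Ψ P Q + PA * QB)                            ≤⟨ *-monoʳ-≤ c (gain P Q a∈ b∈ dense sparse) ⟩
        c * (2 * Ψ′ P Q)                                     ∎
        where
        open ≤-Reasoning
        PA = ∑ ys (P ∙ XY x)
        QB = ∑ zs (Q ∙ XZ x)
        regroup : ∀ d w p q → d * (d * d) * w + d * (d * p * (d * q)) ≡ d * (d * d) * (w + p * q)
        regroup = solve-∀
        sparse : 2 * (D * ⟪ P ∙ XY x , Q ∙ XZ x ⟫ YZ) ≤ PA * QB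
        sparse = begin
          2 * (D * ⟪ P ∙ XY x , Q ∙ XZ x ⟫ YZ)   ≤⟨ *-monoʳ-≤ 2 (*-monoʳ-≤ D (≤-trans (block≤τ x P Q) (τ≤∑P x P Q≤1))) ⟩
          2 * (D * PA)                           ≡⟨ *-assoc 2 D PA ⟨
          2 * D * PA                             ≤⟨ *-monoˡ-≤ PA large ⟩
          QB * PA                                ≡⟨ *-comm QB PA ⟩
          PA * QB                                ∎

      -- Pays for `D` times the edges of the cell in three cases: by the area if the cell is not
      -- dense, by the gain in energy if it is dense and has a witness, and by `bad` if it is dense
      -- without a witness, because then every `x` fails some condition.
      cell : ∀ P Q → (∀ z → Q z ≤ 1) →
        (Any (Witness P Q) xs → ∃[ x ] Witness P Q x × XY x ∈ₗ as × XZ x ∈ₗ bs) →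
        c * (2 * Ψ P Q) + D * ⟪ P , Q ⟫ YZ ≤ c * (2 * Ψ′ P Q) + (ar P Q + D * ∑ xs (bad P Q))
      cell P Q Q≤1 found with ar P Q ≤? D * ⟪ P , Q ⟫ YZ | Any.any? (witness? P Q) xs
      ... | no ¬dense | _ = +-mono-≤ (*-monoʳ-≤ c (*-monoʳ-≤ 2 (Ψ≤Ψ′ P Q)))
                                     (≤-trans (<⇒≤ (≰⇒> ¬dense)) (m≤m+n _ _))
      ... | yes dense | yes w = let _ , wx , a∈ , b∈ = found w in
        ≤-trans (witness⇒gain P Q Q≤1 wx a∈ b∈ dense) (m≤m+n _ _)
      ... | yes dense | no ¬w = +-mono-≤ (*-monoʳ-≤ c (*-monoʳ-≤ 2 (Ψ≤Ψ′ P Q)))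
        (≤-trans (*-monoʳ-≤ D (≤-trans (≤-reflexive (e≡∑τ P Q))
          (∑-mono-∈ xs (λ x∈ → ¬witness⇒bad P Q _ (λ wx → ¬w (Any.map (λ { refl → wx }) x∈))))))
          (m≤n+m _ _))

-- Energy increment over all cells

∑₂-+ : {A B : Set} (as : List A) (bs : List B) (g h : A → B → ℕ) →
  ∑[ a ∈ as ] ∑[ b ∈ bs ] (g a b + h a b) ≡ (∑[ a ∈ as ] ∑[ b ∈ bs ] g a b) + (∑[ a ∈ as ] ∑[ b ∈ bs ] h a b)
∑₂-+ as bs g h = trans (∑-cong as (λ a → ∑-+ bs (g a) (h a))) (∑-+ as _ _)

∑₂-*ˡ : {A B : Set} (k : ℕ) (as : List A) (bs : List B) (g : A → B → ℕ) →
  ∑[ a ∈ as ] ∑[ b ∈ bs ] (k * g a b) ≡ k * (∑[ a ∈ as ] ∑[ b ∈ bs ] g a b)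
∑₂-*ˡ k as bs g = trans (∑-cong as (λ a → ∑-*ˡ k bs (g a))) (∑-*ˡ k as _)

∑-*ˡ-≡ : {A : Set} (k : ℕ) (as : List A) {g : A → ℕ} {v : ℕ} → ∑ as g ≡ v → ∑[ a ∈ as ] (k * g a) ≡ k * v
∑-*ˡ-≡ k as eq = trans (∑-*ˡ k as _) (cong (k *_) eq)

*-∑-≤ : {A : Set} (k : ℕ) (as : List A) {g h : A → ℕ} → (∀ a → k * g a ≤ h a) → k * ∑ as g ≤ ∑ as h
*-∑-≤ k as le = ≤-trans (≤-reflexive (sym (∑-*ˡ k as _))) (∑-mono as le)

∑-partition : {A : Set} (as : List A) {𝒫 : List (A → ℕ)} → partition 𝒫 → ∑[ P ∈ 𝒫 ] ∑ as P ≡ length as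
∑-partition as {𝒫} part = trans (∑-swap 𝒫 as (λ P → P))
  (trans (∑-cong as part) (trans (∑-const as 1) (*-identityʳ _)))

𝟙-<-scale : ∀ k a b → k * (𝟙 (k * a <? b) * a) ≤ b
𝟙-<-scale k a b with k * a <? b
... | yes lt = ≤-trans (≤-reflexive (cong (k *_) (*-identityˡ a))) (<⇒≤ lt)
... | no  _  = ≤-trans (≤-reflexive (*-zeroʳ k)) z≤n

𝟙-<-bound : ∀ a b → 𝟙 (a <? b) * a ≤ b
𝟙-<-bound a b with a <? b
... | yes lt = ≤-trans (≤-reflexive (*-identityˡ a)) (<⇒≤ lt)
... | no  _  = z≤n

-- The number of parts after k refinements, each by one set per cell.
parts : ℕ → ℕ
parts zero    = 1
parts (suc k) = parts k * 2 ^ (parts k * parts k)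

steps : ℕ → ℕ
steps D = D * (D * D) * D

module Increment {X Y Z : Set} (xs : List X) (ys : List Y) (zs : List Z) (t : X → Y → Z → ℕ) where
  open TripleSystem xs ys zs t

  module _ (hyp : Linear∧TriangleClosed) (D : ℕ) {n : ℕ}
           (∣xs∣ : length xs ≡ n) (∣ys∣ : length ys ≡ n) (∣zs∣ : length zs ≡ n) where
    open Linear∧TriangleClosed hyp
    open Energy xs ys zs YZ D using (Ψ; module Refine)

    ψ : List (Y → ℕ) → List (Z → ℕ) → ℕ
    ψ 𝒫 𝒬 = ∑[ P ∈ 𝒫 ] ∑[ Q ∈ 𝒬 ] Ψ P Q

    module _ {𝒫 : List (Y → ℕ)} {𝒬 : List (Z → ℕ)} (part𝒫 : partition 𝒫) (part𝒬 : partition 𝒬) where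

      ∑∑ : ((Y → ℕ) → (Z → ℕ) → ℕ) → ℕ
      ∑∑ F = ∑[ P ∈ 𝒫 ] ∑[ Q ∈ 𝒬 ] F P Q

      ∑area : ∑∑ (area xs ys zs) ≡ n * n
      ∑area = trans (trans (∑-cong 𝒫 (λ P → ∑-*ˡ (∑ ys P) 𝒬 (∑ zs))) (∑-*ʳ 𝒫 (∑ ys) _))
        (cong₂ _*_ (trans (∑-partition ys part𝒫) ∣ys∣) (trans (∑-partition zs part𝒬) ∣zs∣))

      ∑e : ∑∑ (λ P Q → ⟨_,_⟩ xs ys zs P Q YZ) ≡ size
      ∑e = begin
        ∑∑ (λ P Q → ⟨_,_⟩ xs ys zs P Q YZ)             ≡⟨ ∑-cong 𝒫 (λ P → ∑-cong 𝒬 (λ Q → e≡∑τ hyp D P Q)) ⟩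
        ∑∑ (λ P Q → ∑[ x ∈ xs ] τ hyp D x P Q)         ≡⟨ ∑-swap₃ 𝒫 𝒬 xs _ ⟩
        ∑[ x ∈ xs ] ∑∑ (τ hyp D x)                     ≡⟨ ∑-cong xs (λ x → ∑-cong 𝒫 (λ P → ∑-τʳ hyp D x P part𝒬)) ⟩
        ∑[ x ∈ xs ] ∑[ P ∈ 𝒫 ] ∑[ y ∈ ys ] (P y * XY x y)
          ≡⟨ ∑-cong xs (λ x → trans (∑-swap 𝒫 ys _) (∑-cong ys (λ y →
               trans (∑-*ʳ 𝒫 (λ P → P y) _) (trans (cong (_* XY x y) (part𝒫 y)) (*-identityˡ _))))) ⟩
        size                                           ∎
        where open ≡-Reasoning

      ∑xs-const : ∀ k → ∑[ x ∈ xs ] k ≡ n * k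
      ∑xs-const k = trans (∑-const xs k) (cong (_* k) ∣xs∣)

      -- For fixed `x` and `P` the sum of `τ x P Q` over `Q` is |A ∩ P|, counted only if it is below
      -- |P| / D. Summing over `P` and `x` gives n² / D.
      ∑bad₁ : D * (∑[ x ∈ xs ] ∑∑ (λ P Q → bad₁ hyp D P Q x)) ≤ n * n
      ∑bad₁ = ≤-trans (*-∑-≤ D xs (λ x → ≤-trans (*-∑-≤ D 𝒫 (λ P → ≤-trans
          (≤-reflexive (cong (D *_) (∑-*ˡ-≡ (𝟙 (D * ∑ ys (P ∙ XY x) <? ∑ ys P)) 𝒬 (∑-τʳ hyp D x P part𝒬))))
          (𝟙-<-scale D (∑ ys (P ∙ XY x)) (∑ ys P))))
          (≤-reflexive (trans (∑-partition ys part𝒫) ∣ys∣))))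
        (≤-reflexive (∑xs-const n))

      ∑bad₂ : D * (∑[ x ∈ xs ] ∑∑ (λ P Q → bad₂ hyp D P Q x)) ≤ n * n
      ∑bad₂ = ≤-trans (*-∑-≤ D xs (λ x → ≤-trans (≤-reflexive (cong (D *_) (∑-swap 𝒫 𝒬 _))) (≤-trans
          (*-∑-≤ D 𝒬 (λ Q → ≤-trans
            (≤-reflexive (cong (D *_) (∑-*ˡ-≡ (𝟙 (D * ∑ zs (Q ∙ XZ x) <? ∑ zs Q)) 𝒫 (∑-τˡ hyp D x Q part𝒫))))
            (𝟙-<-scale D (∑ zs (Q ∙ XZ x)) (∑ zs Q))))
          (≤-reflexive (trans (∑-partition zs part𝒬) ∣zs∣)))))
        (≤-reflexive (∑xs-const n))

      -- For fixed `x` and `Q` the sum over `P` is |B ∩ Q|, counted only if it is below 2D. This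
      -- leaves a bound that is linear in `n`.
      ∑bad₃ : D * (∑[ x ∈ xs ] ∑∑ (λ P Q → bad₃ hyp D P Q x)) ≤ n * (length 𝒬 * (D * (2 * D)))
      ∑bad₃ = ≤-trans (*-∑-≤ D xs (λ x → ≤-trans (≤-reflexive (cong (D *_) (∑-swap 𝒫 𝒬 _))) (≤-trans
          (*-∑-≤ D 𝒬 (λ Q → ≤-trans
            (≤-reflexive (cong (D *_) (∑-*ˡ-≡ (𝟙 (∑ zs (Q ∙ XZ x) <? 2 * D)) 𝒫 (∑-τˡ hyp D x Q part𝒫))))
            (*-monoʳ-≤ D (𝟙-<-bound (∑ zs (Q ∙ XZ x)) (2 * D)))))
          (≤-reflexive (∑-const 𝒬 _)))))
        (≤-reflexive (∑xs-const _))

      ∑bad : ∑∑ (λ P Q → D * ∑ xs (bad hyp D P Q)) ≤ n * n + n * n + n * (length 𝒬 * (D * (2 * D)))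
      ∑bad = begin
        ∑∑ (λ P Q → D * ∑ xs (bad hyp D P Q))                    ≡⟨ ∑₂-*ˡ D 𝒫 𝒬 _ ⟩
        D * ∑∑ (λ P Q → ∑ xs (bad hyp D P Q))                    ≡⟨ cong (D *_) (∑-swap₃ 𝒫 𝒬 xs _) ⟩
        D * (∑[ x ∈ xs ] ∑∑ (λ P Q → bad hyp D P Q x))             ≡⟨ cong (D *_) (∑-cong xs (λ x →
                                                                    trans (∑₂-+ 𝒫 𝒬 _ _) (cong (_+ B₃ x) (∑₂-+ 𝒫 𝒬 _ _)))) ⟩
        D * (∑[ x ∈ xs ] (B₁ x + B₂ x + B₃ x))                     ≡⟨ cong (D *_) (trans (∑-+ xs _ B₃) (cong (_+ ∑ xs B₃) (∑-+ xs B₁ B₂))) ⟩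
        D * (∑ xs B₁ + ∑ xs B₂ + ∑ xs B₃)                        ≡⟨ distrib D (∑ xs B₁) _ _ ⟩
        D * ∑ xs B₁ + D * ∑ xs B₂ + D * ∑ xs B₃                  ≤⟨ +-mono-≤ (+-mono-≤ ∑bad₁ ∑bad₂) ∑bad₃ ⟩
        n * n + n * n + n * (length 𝒬 * (D * (2 * D)))           ∎
        where
        open ≤-Reasoning
        B₁ B₂ B₃ : X → ℕ
        B₁ x = ∑∑ (λ P Q → bad₁ hyp D P Q x)
        B₂ x = ∑∑ (λ P Q → bad₂ hyp D P Q x)
        B₃ x = ∑∑ (λ P Q → bad₃ hyp D P Q x)
        distrib : ∀ d p q r → d * (p + q + r) ≡ d * p + d * q + d * r
        distrib = solve-∀

      -- At most one witness per cell, so that the number of refining sets is bounded in terms of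
      -- the number of parts and not of `n`.
      chosen : (Y → ℕ) → (Z → ℕ) → List X
      chosen P Q with Any.any? (witness? hyp D P Q) xs
      ... | yes w = Any.lookup w ∷ []
      ... | no  _ = []

      witnesses : List X
      witnesses = concatMap (λ P → concatMap (chosen P) 𝒬) 𝒫

      ∣chosen∣ : ∀ P Q → length (chosen P Q) ≤ 1
      ∣chosen∣ P Q with Any.any? (witness? hyp D P Q) xs
      ... | yes _ = ≤-refl
      ... | no  _ = z≤n

      ∣witnesses∣ : length witnesses ≤ length 𝒫 * (length 𝒬 * 1)
      ∣witnesses∣ = length-concatMap _ (λ P → length-concatMap (chosen P) (∣chosen∣ P) 𝒬) 𝒫

      chosen-complete : ∀ P Q → Any (Witness hyp D P Q) xs → ∃[ x ] Witness hyp D P Q x × x ∈ₗ chosen P Q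
      chosen-complete P Q w with Any.any? (witness? hyp D P Q) xs
      ... | yes w′ = Any.lookup w′ , lookup-result w′ , here refl
      ... | no ¬w  = contradiction w ¬w

      as : List (Y → ℕ)
      as = map XY witnesses

      bs : List (Z → ℕ)
      bs = map XZ witnesses

      as≤1 : ≤1-All as
      as≤1 i with ∈-map⁻ XY i
      ... | x , _ , refl = XY≤1 x

      bs≤1 : ≤1-All bs
      bs≤1 i with ∈-map⁻ XZ i
      ... | x , _ , refl = XZ≤1 x

      𝒫′ : List (Y → ℕ)
      𝒫′ = concatMap (refine as) 𝒫

      𝒬′ : List (Z → ℕ)
      𝒬′ = concatMap (refine bs) 𝒬

      open Refine as≤1 bs≤1 using (Ψ′)

      ψ′≡∑∑Ψ′ : ψ 𝒫′ 𝒬′ ≡ ∑∑ Ψ′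
      ψ′≡∑∑Ψ′ = begin
        ∑[ P′ ∈ 𝒫′ ] ∑[ Q′ ∈ 𝒬′ ] Ψ P′ Q′                                     ≡⟨ ∑-concatMap (refine as) 𝒫 _ ⟩
        ∑[ P ∈ 𝒫 ] ∑[ P′ ∈ refine as P ] ∑[ Q′ ∈ 𝒬′ ] Ψ P′ Q′                 ≡⟨ ∑-cong 𝒫 (λ P → ∑-cong (refine as P) (λ P′ → ∑-concatMap (refine bs) 𝒬 _)) ⟩
        ∑[ P ∈ 𝒫 ] ∑[ P′ ∈ refine as P ] ∑[ Q ∈ 𝒬 ] ∑[ Q′ ∈ refine bs Q ] Ψ P′ Q′
                                                                              ≡⟨ ∑-cong 𝒫 (λ P → ∑-swap (refine as P) 𝒬 _) ⟩
        ∑∑ Ψ′                                                                 ∎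
        where open ≡-Reasoning

      -- Summed over all cells, `cell` pays for D · size ≥ 8n² by the gain and an error of at most
      -- 4n²: n² from the areas, n² each from `bad₁` and `bad₂`, and n² from `bad₃` because `n` is
      -- large compared with the number of parts. So 4n² remain as gain.
      increment : (length 𝒬 * (D * (2 * D))) ≤ n → 8 * (n * n) ≤ D * size →
        c hyp D * (2 * ψ 𝒫 𝒬) + 4 * (n * n) ≤ c hyp D * (2 * ψ 𝒫′ 𝒬′)
      increment few many = +-cancelʳ-≤ (4 * (n * n)) _ _ (begin
        C * (2 * ψ 𝒫 𝒬) + 4 * (n * n) + 4 * (n * n)            ≡⟨ eight (C * (2 * ψ 𝒫 𝒬)) (n * n) ⟩
        C * (2 * ψ 𝒫 𝒬) + 8 * (n * n)                          ≤⟨ +-monoʳ-≤ _ many ⟩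
        C * (2 * ψ 𝒫 𝒬) + D * size                             ≡⟨ cong₂ _+_ (cong (λ w → C * w) (∑₂-*ˡ 2 𝒫 𝒬 Ψ)) (cong (D *_) ∑e) ⟨
        C * ∑∑ (λ P Q → 2 * Ψ P Q) + D * ∑∑ (λ P Q → ⟨_,_⟩ xs ys zs P Q YZ)
                                                               ≡⟨ cong₂ _+_ (∑₂-*ˡ C 𝒫 𝒬 _) (∑₂-*ˡ D 𝒫 𝒬 _) ⟨
        ∑∑ (λ P Q → C * (2 * Ψ P Q)) + ∑∑ (λ P Q → D * ⟨_,_⟩ xs ys zs P Q YZ)
                                                               ≡⟨ ∑₂-+ 𝒫 𝒬 _ _ ⟨
        ∑∑ (λ P Q → C * (2 * Ψ P Q) + D * ⟨_,_⟩ xs ys zs P Q YZ)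
                                                               ≤⟨ ∑-mono-∈ 𝒫 (λ {P} P∈ → ∑-mono-∈ 𝒬 (λ {Q} Q∈ →
                                                                    cell hyp D as≤1 bs≤1 P Q (Q≤1 Q∈) (found P∈ Q∈))) ⟩
        ∑∑ (λ P Q → C * (2 * Ψ′ P Q) + (area xs ys zs P Q + D * ∑ xs (bad hyp D P Q)))
                                                               ≡⟨ trans (∑₂-+ 𝒫 𝒬 _ _) (cong₂ _+_ (∑₂-*ˡ C 𝒫 𝒬 _) (∑₂-+ 𝒫 𝒬 _ _)) ⟩
        C * ∑∑ (λ P Q → 2 * Ψ′ P Q) + (∑∑ (area xs ys zs) + ∑∑ (λ P Q → D * ∑ xs (bad hyp D P Q)))
                                                               ≡⟨ cong₂ _+_ (cong (C *_) (trans (∑₂-*ˡ 2 𝒫 𝒬 Ψ′) (cong (2 *_) (sym ψ′≡∑∑Ψ′)))) (cong (_+ ∑∑ (λ P Q → D * ∑ xs (bad hyp D P Q))) ∑area) ⟩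
        C * (2 * ψ 𝒫′ 𝒬′) + (n * n + ∑∑ (λ P Q → D * ∑ xs (bad hyp D P Q)))
                                                               ≤⟨ +-monoʳ-≤ (C * (2 * ψ 𝒫′ 𝒬′)) (+-monoʳ-≤ (n * n) (≤-trans ∑bad (+-monoʳ-≤ _ (*-monoʳ-≤ n few)))) ⟩
        C * (2 * ψ 𝒫′ 𝒬′) + (n * n + (n * n + n * n + n * n))  ≡⟨ four (C * (2 * ψ 𝒫′ 𝒬′)) (n * n) ⟩
        C * (2 * ψ 𝒫′ 𝒬′) + 4 * (n * n)                        ∎)
        where
        open ≤-Reasoning
        C = c hyp D
        eight : ∀ a b → a + 4 * b + 4 * b ≡ a + 8 * b
        eight = solve-∀
        four : ∀ a b → a + (b + (b + b + b)) ≡ a + 4 * b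
        four = solve-∀
        Q≤1 : ∀ {Q} → Q ∈ₗ 𝒬 → ∀ z → Q z ≤ 1
        Q≤1 Q∈ z = ≤-trans (∈⇒≤∑ (λ Q → Q z) Q∈) (≤-reflexive (part𝒬 z))
        found : ∀ {P Q} → P ∈ₗ 𝒫 → Q ∈ₗ 𝒬 → Any (Witness hyp D P Q) xs →
          ∃[ x ] Witness hyp D P Q x × XY x ∈ₗ as × XZ x ∈ₗ bs
        found {P} {Q} P∈ Q∈ w =
          let x , wx , x∈ = chosen-complete P Q w
              x∈W = ∈-concatMap⁺ _ (lose P∈ (∈-concatMap⁺ _ (lose Q∈ x∈)))
          in x , wx , ∈-map⁺ XY x∈W , ∈-map⁺ XZ x∈W

      ∣concat-refine∣ : {A : Set} {k : ℕ} (cs : List (A → ℕ)) → length cs ≤ k → (ℛ : List (A → ℕ)) →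
        length (concatMap (refine cs) ℛ) ≤ length ℛ * 2 ^ k
      ∣concat-refine∣ cs cs≤k = length-concatMap (refine cs)
        (λ R → ≤-trans (≤-reflexive (length-refine cs R)) (^-monoʳ-≤ 2 cs≤k))

      ∣𝒫′∣ : ∀ {k} → length 𝒫 ≤ k → length 𝒬 ≤ k → length 𝒫′ ≤ k * 2 ^ (k * k)
      ∣𝒫′∣ p q = ≤-trans (∣concat-refine∣ as (≤-trans (≤-reflexive (length-map XY witnesses)) (≤-trans ∣witnesses∣
        (*-mono-≤ p (≤-trans (≤-reflexive (*-identityʳ _)) q)))) 𝒫) (*-monoˡ-≤ _ p)

      ∣𝒬′∣ : ∀ {k} → length 𝒫 ≤ k → length 𝒬 ≤ k → length 𝒬′ ≤ k * 2 ^ (k * k)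
      ∣𝒬′∣ p q = ≤-trans (∣concat-refine∣ bs (≤-trans (≤-reflexive (length-map XZ witnesses)) (≤-trans ∣witnesses∣
        (*-mono-≤ p (≤-trans (≤-reflexive (*-identityʳ _)) q)))) 𝒬) (*-monoˡ-≤ _ q)

    ψ-bounded : ∀ {𝒫 𝒬} → partition 𝒫 → partition 𝒬 → ψ 𝒫 𝒬 ≤ D * (n * n)
    ψ-bounded {𝒫} {𝒬} part𝒫 part𝒬 = begin
      ψ 𝒫 𝒬                                                           ≤⟨ ∑-mono 𝒫 (λ P → ∑-mono 𝒬 (λ Q →
                                                                          ≤-trans (m∸n≤m _ (area xs ys zs P Q)) (*-monoʳ-≤ D (e≤area hyp D P Q)))) ⟩
      ∑[ P ∈ 𝒫 ] ∑[ Q ∈ 𝒬 ] (D * area xs ys zs P Q)                   ≡⟨ ∑₂-*ˡ D 𝒫 𝒬 _ ⟩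
      D * (∑[ P ∈ 𝒫 ] ∑[ Q ∈ 𝒬 ] area xs ys zs P Q)                   ≡⟨ cong (D *_) (∑area part𝒫 part𝒬) ⟩
      D * (n * n)                                                     ∎
      where open ≤-Reasoning

    iterate : 8 * (n * n) ≤ D * size → ∀ k → parts k * (D * (2 * D)) ≤ n →
      ∃[ 𝒫 ] ∃[ 𝒬 ] partition 𝒫 × partition 𝒬 × length 𝒫 ≤ parts k × length 𝒬 ≤ parts k ×
        k * (4 * (n * n)) ≤ c hyp D * (2 * ψ 𝒫 𝒬)
    iterate many zero    few = (λ _ → 1) ∷ [] , (λ _ → 1) ∷ [] , (λ _ → ∑-single _ _) , (λ _ → ∑-single _ _) ,
      ≤-refl , ≤-refl , z≤n
    iterate many (suc k) few =
      let few′ = ≤-trans (*-monoˡ-≤ (D * (2 * D)) (m≤m*n (parts k) (2 ^ (parts k * parts k)) {{m^n≢0 2 (parts k * parts k)}})) few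
          𝒫 , 𝒬 , part𝒫 , part𝒬 , p , q , le = iterate many k few′
      in 𝒫′ part𝒫 part𝒬 , 𝒬′ part𝒫 part𝒬 ,
         refine-partition _ (as≤1 part𝒫 part𝒬) part𝒫 , refine-partition _ (bs≤1 part𝒫 part𝒬) part𝒬 ,
         ∣𝒫′∣ part𝒫 part𝒬 p q , ∣𝒬′∣ part𝒫 part𝒬 p q ,
         ≤-trans (≤-reflexive (+-comm (4 * (n * n)) _)) (≤-trans (+-monoˡ-≤ (4 * (n * n)) le)
           (increment part𝒫 part𝒬 (≤-trans (*-monoˡ-≤ (D * (2 * D)) q) few′) many))

    -- After D⁴ increments `c * (2 * ψ 𝒫 𝒬)` would be at least 4 D⁴ n², whereas ψ ≤ D n² and c = D³
    -- bound it by 2 D⁴ n².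
    few-triples : 0 < n → parts (steps D) * (D * (2 * D)) ≤ n → ¬ (0 < steps D × 8 * (n * n) ≤ D * size)
    few-triples 0<n few (0<steps , many) with iterate many (steps D) few
    ... | 𝒫 , 𝒬 , part𝒫 , part𝒬 , _ , _ , le = <-irrefl refl (begin-strict
      2 * (steps D * (n * n))                    <⟨ m<n+m _ (*-mono-≤ 0<2 (*-mono-≤ 0<steps (*-mono-≤ 0<n 0<n))) ⟩
      2 * (steps D * (n * n)) + 2 * (steps D * (n * n))
                                               ≡⟨ double (steps D) (n * n) ⟩
      steps D * (4 * (n * n))                    ≤⟨ le ⟩
      c hyp D * (2 * ψ 𝒫 𝒬)                    ≤⟨ *-monoʳ-≤ (c hyp D) (*-monoʳ-≤ 2 (ψ-bounded part𝒫 part𝒬)) ⟩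
      c hyp D * (2 * (D * (n * n)))            ≡⟨ regroup (c hyp D) D (n * n) ⟩
      2 * (steps D * (n * n))                    ∎)
      where
      open ≤-Reasoning
      0<2 : 0 < 2
      0<2 = s≤s z≤n
      double : ∀ s w → 2 * (s * w) + 2 * (s * w) ≡ s * (4 * w)
      double = solve-∀
      regroup : ∀ p d w → p * (2 * (d * w)) ≡ 2 * (p * d * w)
      regroup = solve-∀

ruzsa-szemerédi : ∀ m → ∃[ N ] ∀ {n} → N ≤ n → {X Y Z : Set} (xs : List X) (ys : List Y) (zs : List Z) →
  length xs ≡ n → length ys ≡ n → length zs ≡ n → (t : X → Y → Z → ℕ) →
  TripleSystem.Linear∧TriangleClosed xs ys zs t → m * TripleSystem.size xs ys zs t ≤ n * n
ruzsa-szemerédi zero    = 0 , λ _ _ _ _ _ _ _ _ _ → z≤n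
ruzsa-szemerédi m@(suc _) = suc N , λ {n} N<n xs ys zs ∣xs∣ ∣ys∣ ∣zs∣ t hyp → ≮⇒≥ (λ n²<m∙size →
    Increment.few-triples xs ys zs t hyp D ∣xs∣ ∣ys∣ ∣zs∣ (≤-trans (s≤s z≤n) N<n) (≤-trans (n≤1+n N) N<n)
      (s≤s z≤n , ≤-trans (*-monoʳ-≤ 8 (<⇒≤ n²<m∙size)) (≤-reflexive (sym (*-assoc 8 m _)))))
  where
  -- Turns n² < m · size into the hypothesis 8n² ≤ D · size of `few-triples`. The threshold is
  -- `suc N` rather than `N` to ensure 0 < n.
  D = 8 * m
  N = parts (steps D) * (D * (2 * D))

-- Linear spaces without triangles of long lines

∑𝟙-zero : {A : Set} {P : A → Set} (P? : Decidable P) (xs : List A) →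
  (∀ {x} → x ∈ₗ xs → ¬ P x) → ∑[ x ∈ xs ] 𝟙 (P? x) ≡ 0
∑𝟙-zero P? []       none = ∑-[] _
∑𝟙-zero P? (x ∷ xs) none with P? x in eq
... | yes p = contradiction p (none (here refl))
... | no  _ = trans (∑-∷ x xs _) (cong₂ _+_ (cong 𝟙 eq) (∑𝟙-zero P? xs (none ∘ there)))

∑𝟙-unique : {A : Set} {P : A → Set} (P? : Decidable P) {xs : List A} → Unique xs →
  (∀ {x y} → P x → P y → x ≡ y) → ∑[ x ∈ xs ] 𝟙 (P? x) ≤ 1
∑𝟙-unique P? {[]}     []       one = ≤-trans (≤-reflexive (∑-[] _)) z≤n
∑𝟙-unique P? {x ∷ xs} (x∉ ∷ u) one with P? x in eq
... | yes p = ≤-reflexive (trans (∑-∷ x xs _) (cong₂ _+_ (cong 𝟙 eq)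
                (∑𝟙-zero P? xs (λ y∈ q → All.lookup x∉ y∈ (one p q)))))
... | no  _ = ≤-trans (≤-reflexive (trans (∑-∷ x xs _) (cong (_+ _) (cong 𝟙 eq)))) (∑𝟙-unique P? u one)

data Edge : Set where
  edge₁₂ edge₂₃ edge₁₃ : Edge

-- Only lines with at least three points are visible to `L`. In `triangle` the points `u`, `v`, `w`
-- certify that the three connecting lines are long.
record LineSpace (n : ℕ) : Set₁ where
  field
    L        : Fin n → Fin n → Fin n → Set
    L?       : ∀ x y z → Dec (L x y z)
    swap₁₂   : ∀ {x y z} → L x y z → L y x z
    swap₂₃   : ∀ {x y z} → L x y z → L x z y
    distinct : ∀ {x y z} → L x y z → x ≢ y
    L-trans  : ∀ {x y z w} → L x y z → L x y w → z ≢ w → L x z w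
    triangle : ∀ {x y z u v w} → L x y u → L y z v → L x z w → L x y z

  rotate : ∀ {x y z} → L x y z → L y z x
  rotate = swap₂₃ ∘ swap₁₂

  _between_and_ : Fin n → Fin n → Fin n → Set
  w between x and y = x Fin.< w × w Fin.< y × L x w y

  between? : ∀ x y → Dec (∃[ w ] w between x and y)
  between? x y = any? (λ w → (x <ᶠ? w) ×-dec (w <ᶠ? y) ×-dec L? x w y)

  Consecutive : Fin n → Fin n → Fin n → Set
  Consecutive x y z = x Fin.< y × y Fin.< z × L x y z ×
    ¬ (∃[ w ] w between x and y) × ¬ (∃[ w ] w between y and z)

  consecutive? : ∀ x y z → Dec (Consecutive x y z)
  consecutive? x y z = (x <ᶠ? y) ×-dec (y <ᶠ? z) ×-dec L? x y z ×-dec ¬? (between? x y) ×-dec ¬? (between? y z)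

  t : Fin n → Fin n → Fin n → ℕ
  t x y z = 𝟙 (consecutive? x y z)

  -- Two candidates lie on one line by `L-trans`, so one of them would fall into a gap of the other
  -- triple. The same argument gives `unique₁` and `unique₂`.
  unique₃ : ∀ {x y z z′} → Consecutive x y z → Consecutive x y z′ → z ≡ z′
  unique₃ {x} {y} {z} {z′} (_ , y<z , l , _ , gap) (_ , y<z′ , l′ , _ , gap′) with <ᶠ-cmp z z′
  ... | tri≈ _ z≡z′ _ = z≡z′
  ... | tri< z<z′ _ _ = contradiction (z , y<z , z<z′ , L-trans (swap₁₂ l) (swap₁₂ l′) (<ᶠ⇒≢ z<z′)) gap′
  ... | tri> _ _ z′<z = contradiction (z′ , y<z′ , z′<z , L-trans (swap₁₂ l′) (swap₁₂ l) (<ᶠ⇒≢ z′<z)) gap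

  unique₁ : ∀ {y z x x′} → Consecutive x y z → Consecutive x′ y z → x ≡ x′
  unique₁ {y} {z} {x} {x′} (x<y , _ , l , gap , _) (x′<y , _ , l′ , gap′ , _) with <ᶠ-cmp x x′
  ... | tri≈ _ x≡x′ _ = x≡x′
  ... | tri< x<x′ _ _ = contradiction (x′ , x<x′ , x′<y , rotate (L-trans (rotate l) (rotate l′) (<ᶠ⇒≢ x<x′))) gap
  ... | tri> _ _ x′<x = contradiction (x , x′<x , x<y , rotate (L-trans (rotate l′) (rotate l) (<ᶠ⇒≢ x′<x))) gap′

  unique₂ : ∀ {x z y y′} → Consecutive x y z → Consecutive x y′ z → y ≡ y′
  unique₂ {x} {z} {y} {y′} (x<y , y<z , l , gap , gap₂) (x<y′ , y′<z , l′ , gap′ , gap₂′) with <ᶠ-cmp y y′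
  ... | tri≈ _ y≡y′ _ = y≡y′
  ... | tri< y<y′ _ _ = contradiction (y , x<y , y<y′ , L-trans (swap₂₃ l) (swap₂₃ l′) (<ᶠ⇒≢ y<y′)) gap′
  ... | tri> _ _ y′<y = contradiction (y′ , x<y′ , y′<y , L-trans (swap₂₃ l′) (swap₂₃ l) (<ᶠ⇒≢ y′<y)) gap

  -- The three pairs lie on long lines, so `triangle` applies; the two gaps are inherited from the
  -- triples containing `x`, `y` and `y`, `z`. This gives both the closedness of the system and its
  -- recovery from the projections.
  join : ∀ {x y z x′ y′ z′} → Consecutive x y z′ → Consecutive x y′ z → Consecutive x′ y z → Consecutive x y z
  join (x<y , _ , l , gap , _) (_ , _ , l′ , _) (_ , y<z , l″ , _ , gap′) =
    x<y , y<z , triangle l (rotate l″) (swap₂₃ l′) , gap , gap′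

  open TripleSystem (allFin n) (allFin n) (allFin n) t public

  linear∧triangleClosed : Linear∧TriangleClosed
  linear∧triangleClosed = record
    { XY≤1   = XY≤1
    ; XZ≤1   = XZ≤1
    ; YZ≤1   = YZ≤1
    ; closed = closed
    }
    where
    XY≤1 : ∀ x y → XY x y ≤ 1
    XY≤1 x y = ∑𝟙-unique (consecutive? x y) (Uniqueₚ.allFin⁺ n) unique₃

    XZ≤1 : ∀ x z → XZ x z ≤ 1
    XZ≤1 x z = ∑𝟙-unique (λ y → consecutive? x y z) (Uniqueₚ.allFin⁺ n) unique₂

    YZ≤1 : ∀ y z → YZ y z ≤ 1
    YZ≤1 y z = ∑𝟙-unique (λ x → consecutive? x y z) (Uniqueₚ.allFin⁺ n) unique₁

    closed : ∀ x y z → XY x y * XZ x z * YZ y z ≤ t x y z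
    closed x y z with any? (consecutive? x y) | any? (λ y′ → consecutive? x y′ z) | any? (λ x′ → consecutive? x′ y z)
    ... | yes (_ , p) | yes (_ , q) | yes (_ , r) = ≤-trans
      (*-mono-≤ (*-mono-≤ (XY≤1 x y) (XZ≤1 x z)) (YZ≤1 y z))
      (≤-reflexive (sym (𝟙-yes (consecutive? x y z) (join p q r))))
    ... | no ¬p | _ | _ = ≤-trans (≤-reflexive (cong (λ k → k * XZ x z * YZ y z)
      (∑𝟙-zero (consecutive? x y) (allFin n) (λ _ p → ¬p (_ , p))))) z≤n
    ... | yes _ | no ¬q | _ = ≤-trans (≤-reflexive (trans (cong (λ k → XY x y * k * YZ y z)
      (∑𝟙-zero (λ y′ → consecutive? x y′ z) (allFin n) (λ _ p → ¬q (_ , p)))) (cong (_* YZ y z) (*-zeroʳ (XY x y))))) z≤n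
    ... | yes _ | yes _ | no ¬r = ≤-trans (≤-reflexive (trans (cong (XY x y * XZ x z *_)
      (∑𝟙-zero (λ x′ → consecutive? x′ y z) (allFin n) (λ _ p → ¬r (_ , p)))) (*-zeroʳ (XY x y * XZ x z)))) z≤n

  Projection : Edge → Fin n → Fin n → Set
  Projection edge₁₂ x y = ∃[ z ] Consecutive x y z
  Projection edge₂₃ y z = ∃[ x ] Consecutive x y z
  Projection edge₁₃ x z = ∃[ y ] Consecutive x y z

  projection? : ∀ s x y → Dec (Projection s x y)
  projection? edge₁₂ x y = any? (consecutive? x y)
  projection? edge₂₃ y z = any? (λ x → consecutive? x y z)
  projection? edge₁₃ x z = any? (λ y → consecutive? x y z)

-- Recovering the lines from the projections of consecutive triples

module _ {n : ℕ} (𝓛 𝓛′ : LineSpace n) where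
  private
    module L  = LineSpace 𝓛
    module L′ = LineSpace 𝓛′

  module _ (consecutive⊆ : ∀ {x y z} → L.Consecutive x y z → L′.Consecutive x y z) where

    -- Induction on a bound `k` for z - x. If a point `w` of the line lies in a gap, then `w` and
    -- `y` form a triple of smaller extent with `x` and another with `z`. Both lie on lines of `𝓛′`
    -- and share two points, so they lie on one line.
    sorted⊆ : ∀ k {x y z} → toℕ z ≤ toℕ x + k → x Fin.< y → y Fin.< z → L.L x y z → L′.L x y z
    sorted⊆ zero {x} {y} {z} z≤ x<y y<z l =
      contradiction (<-≤-trans (<-trans x<y y<z) (≤-trans z≤ (≤-reflexive (+-identityʳ _)))) (<-irrefl refl)
    sorted⊆ (suc k) {x} {y} {z} z≤ x<y y<z l with L.between? x y | L.between? y z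
    ... | no gap | no gap′ = proj₁ (proj₂ (proj₂ (consecutive⊆ (x<y , y<z , l , gap , gap′))))
    ... | yes (w , x<w , w<y , m) | _ = L′.swap₁₂ (L′.L-trans (L′.swap₁₂ (L′.rotate lower)) (L′.swap₁₂ upper) (<ᶠ⇒≢ (<-trans x<y y<z)))
      where
      lower : L′.L x w y
      lower = sorted⊆ k (≤-pred (≤-trans y<z (≤-trans z≤ (≤-reflexive (+-suc _ k))))) x<w w<y m
      upper : L′.L w y z
      upper = sorted⊆ k (≤-trans z≤ (≤-trans (≤-reflexive (+-suc (toℕ x) k)) (+-monoˡ-≤ k x<w))) w<y y<z
        (L.swap₁₂ (L.L-trans (L.swap₁₂ (L.swap₂₃ m)) (L.swap₁₂ l) (<ᶠ⇒≢ (<-trans w<y y<z))))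
    ... | no _ | yes (w , y<w , w<z , m) = L′.swap₁₂ (L′.L-trans (L′.rotate lower) upper (<ᶠ⇒≢ (<-trans x<y y<z)))
      where
      lower : L′.L x y w
      lower = sorted⊆ k (≤-pred (≤-trans w<z (≤-trans z≤ (≤-reflexive (+-suc _ k))))) x<y y<w
        (L.rotate (L.rotate (L.L-trans (L.swap₂₃ m) (L.rotate l) (≢-sym (<ᶠ⇒≢ (<-trans x<y y<w))))))
      upper : L′.L y w z
      upper = sorted⊆ k (≤-trans z≤ (≤-trans (≤-reflexive (+-suc (toℕ x) k)) (+-monoˡ-≤ k x<y))) y<w w<z m

    private
      sorted : ∀ {x y z} → x Fin.< y → y Fin.< z → L.L x y z → L′.L x y z
      sorted {x} {z = z} = sorted⊆ (toℕ z) (m≤n+m (toℕ z) (toℕ x))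

    collinear⊆ : ∀ {x y z} → L.L x y z → L′.L x y z
    collinear⊆ {x} {y} {z} l with <ᶠ-cmp x y | <ᶠ-cmp y z | <ᶠ-cmp x z
    ... | tri≈ _ x≡y _ | _            | _            = contradiction x≡y (L.distinct l)
    ... | tri< _ _ _   | tri≈ _ y≡z _ | _            = contradiction y≡z (L.distinct (L.rotate l))
    ... | tri> _ _ _   | tri≈ _ y≡z _ | _            = contradiction y≡z (L.distinct (L.rotate l))
    ... | tri< _ _ _   | tri> _ _ _   | tri≈ _ x≡z _ = contradiction x≡z (L.distinct (L.swap₂₃ l))
    ... | tri> _ _ _   | tri< _ _ _   | tri≈ _ x≡z _ = contradiction x≡z (L.distinct (L.swap₂₃ l))
    ... | tri< x<y _ _ | tri< y<z _ _ | _            = sorted x<y y<z l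
    ... | tri< _ _ _   | tri> _ _ z<y | tri< x<z _ _ = L′.swap₂₃ (sorted x<z z<y (L.swap₂₃ l))
    ... | tri< x<y _ _ | tri> _ _ _   | tri> _ _ z<x = L′.rotate (sorted z<x x<y (L.rotate (L.rotate l)))
    ... | tri> _ _ y<x | tri< _ _ _   | tri< x<z _ _ = L′.swap₁₂ (sorted y<x x<z (L.swap₁₂ l))
    ... | tri> _ _ _   | tri< y<z _ _ | tri> _ _ z<x = L′.rotate (L′.rotate (sorted y<z z<x (L.rotate l)))
    ... | tri> _ _ y<x | tri> _ _ z<y | _            =
      L′.swap₁₂ (L′.rotate (sorted z<y y<x (L.swap₁₂ (L.rotate l))))

  -- The three pairs of a consecutive triple of `𝓛` may come from three different triples of `𝓛′`;
  -- `join` merges these into one.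
  projections-determine : (∀ s {x y} → L.Projection s x y → L′.Projection s x y) →
    ∀ {x y z} → L.L x y z → L′.L x y z
  projections-determine proj⊆ = collinear⊆ (λ c → L′.join
    (proj₂ (proj⊆ edge₁₂ (_ , c))) (proj₂ (proj⊆ edge₁₃ (_ , c))) (proj₂ (proj⊆ edge₂₃ (_ , c))))

𝟙-any≤∑ : {n : ℕ} {P : Fin n → Set} (P? : Decidable P) → 𝟙 (any? P?) ≤ ∑[ x ∈ allFin n ] 𝟙 (P? x)
𝟙-any≤∑ P? with any? P?
... | yes (x , p) = ≤-trans (≤-reflexive (sym (𝟙-yes (P? x) p))) (∈⇒≤∑ (𝟙 ∘ P?) (∈-allFin x))
... | no _        = z≤n

module _ {n : ℕ} (𝓛 : LineSpace n) where
  open LineSpace 𝓛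

  ∑projection : ∀ s → ∑[ x ∈ allFin n ] ∑[ y ∈ allFin n ] 𝟙 (projection? s x y) ≤ size
  ∑projection edge₁₂ = ∑-mono (allFin n) (λ x → ∑-mono (allFin n) (λ y → 𝟙-any≤∑ (consecutive? x y)))
  ∑projection edge₂₃ = ≤-trans
    (∑-mono (allFin n) (λ y → ∑-mono (allFin n) (λ z → 𝟙-any≤∑ (λ x → consecutive? x y z))))
    (≤-reflexive (∑-swap₃ (allFin n) (allFin n) (allFin n) (λ y z x → t x y z)))
  ∑projection edge₁₃ = ≤-trans
    (∑-mono (allFin n) (λ x → ∑-mono (allFin n) (λ z → 𝟙-any≤∑ (λ y → consecutive? x y z))))
    (≤-reflexive (∑-cong (allFin n) (λ x → ∑-swap (allFin n) (allFin n) (λ z y → t x y z))))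

-- Finite setoids

module _ (S : Setoid ℓ₁ ℓ₂) where
  open Setoid S renaming (refl to ≈-refl; sym to ≈-sym; trans to ≈-trans)
  open SetoidMembership S using () renaming (_∈_ to _∈ₛ_)
  open SetoidUnique S using () renaming (Unique to Uniqueₛ)

  lookup-injective : ∀ {xs} → Uniqueₛ xs → ∀ i j → lookup xs i ≈ lookup xs j → i ≡ j
  lookup-injective (_ ∷ _)  zero    zero    _  = refl
  lookup-injective (x∉ ∷ _) zero    (suc j) eq = contradiction eq (All.lookup x∉ (∈-lookup j))
  lookup-injective (x∉ ∷ _) (suc i) zero    eq = contradiction (≈-sym eq) (All.lookup x∉ (∈-lookup i))
  lookup-injective (_ ∷ u)  (suc i) (suc j) eq = cong suc (lookup-injective u i j eq)

  hasCardinality : ∀ xs → Uniqueₛ xs → (∀ x → x ∈ₛ xs) → HasCardinality S (length xs)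
  hasCardinality xs unique complete = record
    { to        = lookup xs
    ; from      = position
    ; to-cong   = λ { refl → ≈-refl }
    ; from-cong = λ {x} {y} x≈y → lookup-injective unique _ _
        (≈-trans (≈-sym (lookup-index (complete x))) (≈-trans x≈y (lookup-index (complete y))))
    ; inverse   = (λ { {x} refl → ≈-sym (lookup-index (complete x)) }) ,
        λ {i} {x} x≈ → lookup-injective unique _ _ (≈-trans (≈-sym (lookup-index (complete x))) x≈)
    }
    where
    position : Carrier → Fin (length xs)
    position x = Any.index (complete x)

  cardinality-≤ : ∀ {k} → HasCardinality S k → {C : Set} (cs : List C) (code : Carrier → C) →
    (∀ x → code x ∈ₗ cs) → (∀ {x y} → code x ≡ code y → x ≈ y) → k ≤ length cs
  cardinality-≤ card cs code code∈ injective = injective⇒≤ {f = λ i → Any.index (code∈ (to i))} λ {i} {j} eq →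
    trans (sym (strictlyInverseʳ i)) (trans (from-cong (injective (trans (lookup-index (code∈ (to i)))
      (trans (cong (lookup cs) eq) (sym (lookup-index (code∈ (to j)))))))) (strictlyInverseʳ j))
    where open Inverse card using (to; strictlyInverseʳ; from-cong)

  cardinality-positive : ∀ {k} → HasCardinality S k → Carrier → 0 < k
  cardinality-positive card x = nonempty (Inverse.from card x)
    where
    nonempty : ∀ {k} → Fin k → 0 < k
    nonempty zero    = s≤s z≤n
    nonempty (suc _) = s≤s z≤n

module _ (S : DecSetoid ℓ₁ ℓ₂) where
  open DecSetoid S using (_≈_; Carrier) renaming (setoid to S′; _≟_ to _≈?_; sym to ≈-sym; trans to ≈-trans)

  finite : ∀ xs → (∀ x → Any (x ≈_) xs) → ∃[ k ] HasCardinality S′ k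
  finite xs complete = _ , hasCardinality S′ (deduplicate _≈?_ xs) (deduplicate-! S xs)
    (λ x → SetoidMembershipₚ.∈-deduplicate⁺ S′ _≈?_ (λ z≈y x≈y → ≈-trans x≈y (≈-sym z≈y)) (complete x))

sublists : {A : Set} → List A → List (List A)
sublists []       = [] ∷ []
sublists (x ∷ xs) = map (x ∷_) (sublists xs) ++ sublists xs

filter∈sublists : {A : Set} {P : A → Set} (P? : Decidable P) (xs : List A) → filter P? xs ∈ₗ sublists xs
filter∈sublists P? []       = here refl
filter∈sublists P? (x ∷ xs) with P? x
... | yes _ = ∈-++⁺ˡ (∈-map⁺ (x ∷_) (filter∈sublists P? xs))
... | no _  = ∈-++⁺ʳ (map (x ∷_) (sublists xs)) (filter∈sublists P? xs)

subsets : ∀ n → List (Subset n)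
subsets zero    = [] ∷ []
subsets (suc n) = map (outside ∷_) (subsets n) ++ map (inside ∷_) (subsets n)

∈-subsets : ∀ {n} (X : Subset n) → X ∈ₗ subsets n
∈-subsets []            = here refl
∈-subsets (outside ∷ X) = ∈-++⁺ˡ (∈-map⁺ (outside ∷_) (∈-subsets X))
∈-subsets (inside ∷ X)  = ∈-++⁺ʳ (map (outside ∷_) (subsets _)) (∈-map⁺ (inside ∷_) (∈-subsets X))

-- Sparse bit strings

weight : List Bool → ℕ
weight []           = 0
weight (true  ∷ bs) = suc (weight bs)
weight (false ∷ bs) = weight bs

light : ℕ → ℕ → List (List Bool)
light zero    w       = [] ∷ []
light (suc N) zero    = map (false ∷_) (light N zero)
light (suc N) (suc w) = map (false ∷_) (light N (suc w)) ++ map (true ∷_) (light N w)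

∈-light : ∀ bs {w} → weight bs ≤ w → bs ∈ₗ light (length bs) w
∈-light []           _                 = here refl
∈-light (false ∷ bs) {zero}  le        = ∈-map⁺ (false ∷_) (∈-light bs le)
∈-light (false ∷ bs) {suc w} le        = ∈-++⁺ˡ (∈-map⁺ (false ∷_) (∈-light bs le))
∈-light (true  ∷ bs) {suc w} (s≤s le)  =
  ∈-++⁺ʳ (map (false ∷_) (light (length bs) (suc w))) (∈-map⁺ (true ∷_) (∈-light bs le))

-- In the expansion of (1 + 1/K)^N a string of weight v contributes K^(-v), which is at least K^(-w)
-- for the strings listed. So there are at most K^w (1 + 1/K)^N of them; the statement is cleared of
-- denominators.
∣light∣-bound : ∀ K .{{_ : NonZero K}} N w → length (light N w) * K ^ N ≤ K ^ w * suc K ^ N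
∣light∣-bound K zero    w    = ≤-trans (m^n>0 K w) (≤-reflexive (sym (*-identityʳ _)))
∣light∣-bound K (suc N) zero = begin
  length (map (false ∷_) (light N 0)) * (K * K ^ N)   ≡⟨ cong (_* (K * K ^ N)) (length-map _ (light N 0)) ⟩
  length (light N 0) * (K * K ^ N)                    ≡⟨ regroup (length (light N 0)) K (K ^ N) ⟩
  K * (length (light N 0) * K ^ N)                    ≤⟨ *-mono-≤ (n≤1+n K) (∣light∣-bound K N 0) ⟩
  suc K * (1 * suc K ^ N)                             ≡⟨ regroup′ (suc K) (suc K ^ N) ⟩
  1 * (suc K * suc K ^ N)                             ∎
  where
  open ≤-Reasoning
  regroup : ∀ c k p → c * (k * p) ≡ k * (c * p)
  regroup = solve-∀
  regroup′ : ∀ k p → k * (1 * p) ≡ 1 * (k * p)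
  regroup′ = solve-∀
∣light∣-bound K (suc N) (suc w) = begin
  length (light (suc N) (suc w)) * (K * K ^ N)        ≡⟨ cong (_* (K * K ^ N)) (trans (length-++ (map (false ∷_) (light N (suc w))))
                                                          (cong₂ _+_ (length-map _ (light N (suc w))) (length-map _ (light N w)))) ⟩
  (c₁ + c₂) * (K * K ^ N)                             ≡⟨ regroup c₁ c₂ K (K ^ N) ⟩
  K * (c₁ * K ^ N) + K * (c₂ * K ^ N)                 ≤⟨ +-mono-≤ (*-monoʳ-≤ K (∣light∣-bound K N (suc w))) (*-monoʳ-≤ K (∣light∣-bound K N w)) ⟩
  K * (K * K ^ w * suc K ^ N) + K * (K ^ w * suc K ^ N)
                                                      ≡⟨ collect K (K ^ w) (suc K ^ N) ⟩
  K * K ^ w * (suc K * suc K ^ N)                     ∎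
  where
  open ≤-Reasoning
  c₁ = length (light N (suc w))
  c₂ = length (light N w)
  regroup : ∀ c d k p → (c + d) * (k * p) ≡ k * (c * p) + k * (d * p)
  regroup = solve-∀
  collect : ∀ k p s → k * (k * p * s) + k * (p * s) ≡ k * p * ((1 + k) * s)
  collect = solve-∀

-- This is (1 + 1/K)^i ≤ 1 + 2i/K. The induction step leaves a term 2i/K², which is at most 1/K
-- since 2i ≤ K.
bernoulli : ∀ K i → 2 * i ≤ K → suc K ^ i * K ≤ K ^ i * (K + 2 * i)
bernoulli K zero    _  = ≤-reflexive (cong (_+ 0) (sym (+-identityʳ K)))
bernoulli K (suc i) le = begin
  suc K * suc K ^ i * K                     ≡⟨ *-assoc (suc K) (suc K ^ i) K ⟩
  suc K * (suc K ^ i * K)                   ≤⟨ *-monoʳ-≤ (suc K) (bernoulli K i 2i≤K) ⟩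
  suc K * (K ^ i * (K + 2 * i))             ≡⟨ expand K (K ^ i) i ⟩
  K ^ i * (K * (K + 2 * i + 1) + 2 * i)     ≤⟨ *-monoʳ-≤ (K ^ i) (+-monoʳ-≤ (K * (K + 2 * i + 1)) 2i≤K) ⟩
  K ^ i * (K * (K + 2 * i + 1) + K)         ≡⟨ collect K (K ^ i) i ⟩
  K * K ^ i * (K + 2 * suc i)               ∎
  where
  open ≤-Reasoning
  2i≤K : 2 * i ≤ K
  2i≤K = ≤-trans (*-monoʳ-≤ 2 (n≤1+n i)) le
  expand : ∀ k p i → (1 + k) * (p * (k + 2 * i)) ≡ p * (k * (k + 2 * i + 1) + 2 * i)
  expand = solve-∀
  collect : ∀ k p i → p * (k * (k + 2 * i + 1) + k) ≡ k * p * (k + 2 * (1 + i))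
  collect = solve-∀

suc-^-≤ : ∀ K .{{_ : NonZero K}} i → 2 * i ≤ K → suc K ^ i ≤ 2 * K ^ i
suc-^-≤ K i le = *-cancelʳ-≤ _ _ K (begin
  suc K ^ i * K          ≤⟨ bernoulli K i le ⟩
  K ^ i * (K + 2 * i)    ≤⟨ *-monoʳ-≤ (K ^ i) (+-monoʳ-≤ K le) ⟩
  K ^ i * (K + K)        ≡⟨ regroup (K ^ i) K ⟩
  2 * K ^ i * K          ∎)
  where
  open ≤-Reasoning
  regroup : ∀ p k → p * (k + k) ≡ 2 * p * k
  regroup = solve-∀

n≤2^n : ∀ n → n ≤ 2 ^ n
n≤2^n zero    = z≤n
n≤2^n (suc n) = ≤-trans (+-mono-≤ (m^n>0 2 n) (n≤2^n n)) (≤-reflexive (cong (2 ^ n +_) (sym (+-identityʳ _))))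

*-distribʳ-^ : ∀ a b k → (a * b) ^ k ≡ a ^ k * b ^ k
*-distribʳ-^ a b zero    = refl
*-distribʳ-^ a b (suc k) = trans (cong (a * b *_) (*-distribʳ-^ a b k)) (regroup a b (a ^ k) (b ^ k))
  where
  regroup : ∀ a b p q → a * b * (p * q) ≡ a * p * (b * q)
  regroup = solve-∀

square-cancel-≤ : ∀ {a b} → a ^ 2 ≤ b ^ 2 → a ≤ b
square-cancel-≤ le = ≮⇒≥ (λ b<a → <⇒≱ (^-monoˡ-< 2 b<a) le)

-- K = 2 ^ rate q makes (1 + 1/K) ^ (8 q) ≤ 2, by Bernoulli.
rate : ℕ → ℕ
rate q = 2 * (8 * q)

-- Squares are compared, because for strings of length 4s the 2q-th power of the bound K^w (1 +
-- 1/K)^(4s) has two factors, each at most 2^s: K^(2qw) by sparsity and (1 + 1/K)^(8qs) by the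
-- choice of K.
∣light∣-small : ∀ q s w → 8 * rate q * q * w ≤ 4 * s → length (light (4 * s) w) ^ q ≤ 2 ^ s
∣light∣-small q s w sparse = square-cancel-≤ (*-cancelʳ-≤ _ _ (K ^ (8 * q * s)) {{m^n≢0 K (8 * q * s) {{m^n≢0 2 j}}}} (begin
  (c ^ q) ^ 2 * K ^ (8 * q * s)                ≡⟨ cong₂ _*_ (^-*-assoc c q 2) (cong (K ^_) (exponent q s)) ⟩
  c ^ (q * 2) * K ^ (4 * s * (q * 2))          ≡⟨ cong (c ^ (q * 2) *_) (^-*-assoc K (4 * s) (q * 2)) ⟨
  c ^ (q * 2) * (K ^ (4 * s)) ^ (q * 2)        ≡⟨ *-distribʳ-^ c (K ^ (4 * s)) (q * 2) ⟨
  (c * K ^ (4 * s)) ^ (q * 2)                  ≤⟨ ^-monoˡ-≤ (q * 2) (∣light∣-bound K {{m^n≢0 2 j}} (4 * s) w) ⟩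
  (K ^ w * suc K ^ (4 * s)) ^ (q * 2)          ≡⟨ *-distribʳ-^ (K ^ w) (suc K ^ (4 * s)) (q * 2) ⟩
  (K ^ w) ^ (q * 2) * (suc K ^ (4 * s)) ^ (q * 2)
                                               ≡⟨ cong₂ _*_ (trans (^-*-assoc K w (q * 2)) (^-*-assoc 2 j (w * (q * 2))))
                                                            (trans (^-*-assoc (suc K) (4 * s) (q * 2)) (trans (cong (suc K ^_) (sym (exponent q s)))
                                                              (sym (^-*-assoc (suc K) (8 * q) s)))) ⟩
  2 ^ (j * (w * (q * 2))) * (suc K ^ (8 * q)) ^ s
                                               ≤⟨ *-mono-≤ (^-monoʳ-≤ 2 light-weight)
                                                   (^-monoˡ-≤ s (suc-^-≤ K {{m^n≢0 2 j}} (8 * q) (n≤2^n j))) ⟩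
  2 ^ s * (2 * K ^ (8 * q)) ^ s                ≡⟨ cong (2 ^ s *_) (trans (*-distribʳ-^ 2 (K ^ (8 * q)) s) (cong (2 ^ s *_) (^-*-assoc K (8 * q) s))) ⟩
  2 ^ s * (2 ^ s * K ^ (8 * q * s))            ≡⟨ regroup (2 ^ s) (K ^ (8 * q * s)) ⟩
  (2 ^ s) ^ 2 * K ^ (8 * q * s)                ∎))
  where
  open ≤-Reasoning
  j = rate q
  K = 2 ^ j
  c = length (light (4 * s) w)
  exponent : ∀ q s → 8 * q * s ≡ 4 * s * (q * 2)
  exponent = solve-∀
  regroup : ∀ a b → a * (a * b) ≡ a * (a * 1) * b
  regroup = solve-∀
  four : ∀ j q w → 4 * (j * (w * (q * 2))) ≡ 8 * j * q * w
  four = solve-∀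
  light-weight : j * (w * (q * 2)) ≤ s
  light-weight = *-cancelˡ-≤ 4 (≤-trans (≤-reflexive (four j q w)) sparse)

-- Independence in terms of lists

open Matroid
open IsBasisOf

fromList : List (Fin n) → Subset n
fromList []       = ⊥
fromList (x ∷ xs) = ⁅ x ⁆ ∪ fromList xs

∈-fromList⁺ : ∀ {x} {xs : List (Fin n)} → x ∈ₗ xs → x ∈ fromList xs
∈-fromList⁺ (here refl)          = p⊆p∪q _ (x∈⁅x⁆ _)
∈-fromList⁺ {xs = y ∷ _} (there i) = q⊆p∪q ⁅ y ⁆ _ (∈-fromList⁺ i)

∈-fromList⁻ : ∀ {x} (xs : List (Fin n)) → x ∈ fromList xs → x ∈ₗ xs
∈-fromList⁻ []       x∈ = contradiction x∈ ∉⊥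
∈-fromList⁻ (y ∷ xs) x∈ with x∈p∪q⁻ ⁅ y ⁆ (fromList xs) x∈
... | inj₁ i = here (x∈⁅y⁆⇒x≡y y i)
... | inj₂ i = there (∈-fromList⁻ xs i)

∣fromList∣ : {xs : List (Fin n)} → Unique xs → ∣ fromList xs ∣ ≡ length xs
∣fromList∣ {n} []             = ∣⊥∣≡0 n
∣fromList∣ {xs = x ∷ xs} (x∉ ∷ u) = trans
  (∣∪∣-disjoint ⁅ x ⁆ (fromList xs) (λ i j → All¬⇒¬Any x∉ (subst (_∈ₗ xs) (x∈⁅y⁆⇒x≡y x i) (∈-fromList⁻ xs j))))
  (cong₂ _+_ (∣⁅x⁆∣≡1 x) (∣fromList∣ u))

elements : Subset n → List (Fin n)
elements []            = []
elements (inside  ∷ X) = zero ∷ map suc (elements X)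
elements (outside ∷ X) = map suc (elements X)

∈-elements⁺ : ∀ {x} {X : Subset n} → x ∈ X → x ∈ₗ elements X
∈-elements⁺ {X = inside  ∷ X} here      = here refl
∈-elements⁺ {X = inside  ∷ X} (there i) = there (∈-map⁺ suc (∈-elements⁺ i))
∈-elements⁺ {X = outside ∷ X} (there i) = ∈-map⁺ suc (∈-elements⁺ i)

∈-elements⁻ : ∀ {x} (X : Subset n) → x ∈ₗ elements X → x ∈ X
∈-elements⁻ (inside  ∷ X) (here refl) = here
∈-elements⁻ (inside  ∷ X) (there i) with ∈-map⁻ suc i
... | _ , j , refl = there (∈-elements⁻ X j)
∈-elements⁻ (outside ∷ X) i with ∈-map⁻ suc i
... | _ , j , refl = there (∈-elements⁻ X j)

elements-unique : (X : Subset n) → Unique (elements X)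
elements-unique []            = []
elements-unique (inside  ∷ X) =
  ¬Any⇒All¬ _ (λ i → case ∈-map⁻ suc i of λ ()) ∷ Uniqueₚ.map⁺ Finₚ.suc-injective (elements-unique X)
elements-unique (outside ∷ X) = Uniqueₚ.map⁺ Finₚ.suc-injective (elements-unique X)

fromList-elements : (X : Subset n) → fromList (elements X) ≡ X
fromList-elements X = ⊆-antisym (∈-elements⁻ X ∘ ∈-fromList⁻ _) (∈-fromList⁺ ∘ ∈-elements⁺)

∣elements∣ : (X : Subset n) → length (elements X) ≡ ∣ X ∣
∣elements∣ X = trans (sym (∣fromList∣ (elements-unique X))) (cong ∣_∣ (fromList-elements X))

module Independence (M : Matroid n) where

  -- Uniqueness makes the length of the list the cardinality of the set, so that augmentation
  -- applies to explicit lists.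
  I : List (Fin n) → Set
  I xs = Unique xs × Indep M (fromList xs)

  I? : ∀ xs → Dec (I xs)
  I? xs = allPairs? (λ x y → ¬? (x Finₚ.≟ y)) xs ×-dec indep? M (fromList xs)

  I-tail : ∀ {x xs} → I (x ∷ xs) → I xs
  I-tail {x} (_ ∷ u , i) = u , hereditary M i (q⊆p∪q ⁅ x ⁆ _)

  I-↭ : ∀ {xs ys} → xs ↭ ys → I xs → I ys
  I-↭ p (u , i) = Unique-resp-↭ (setoid _) (↭⇒↭ₛ p) u ,
    hereditary M i (∈-fromList⁺ ∘ ∈-resp-↭ (↭-sym p) ∘ ∈-fromList⁻ _)

  I-augment : ∀ {xs ys} → I xs → I ys → length xs < length ys → ∃[ y ] y ∈ₗ ys × I (y ∷ xs)
  I-augment {xs} {ys} (u , i) (v , j) lt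
    with augmentation M i j (subst₂ _<_ (sym (∣fromList∣ u)) (sym (∣fromList∣ v)) lt)
  ... | y , y∈ , y∉ , k = y , ∈-fromList⁻ ys y∈ , ¬Any⇒All¬ xs (y∉ ∘ ∈-fromList⁺) ∷ u ,
        subst (Indep M) (∪-comm _ _) k

  private
    variable
      x y z u v w r s t : Fin n

  aug₁₂ : I (x ∷ []) → I (y ∷ z ∷ []) → I (y ∷ x ∷ []) ⊎ I (z ∷ x ∷ [])
  aug₁₂ i j with I-augment i j ≤-refl
  ... | _ , here refl         , k = inj₁ k
  ... | _ , there (here refl) , k = inj₂ k

  aug₂₃ : I (x ∷ y ∷ []) → I (u ∷ v ∷ w ∷ []) → I (u ∷ x ∷ y ∷ []) ⊎ I (v ∷ x ∷ y ∷ []) ⊎ I (w ∷ x ∷ y ∷ [])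
  aug₂₃ i j with I-augment i j ≤-refl
  ... | _ , here refl                 , k = inj₁ k
  ... | _ , there (here refl)         , k = inj₂ (inj₁ k)
  ... | _ , there (there (here refl)) , k = inj₂ (inj₂ k)

  flip₂ : I (x ∷ y ∷ []) → I (y ∷ x ∷ [])
  flip₂ = I-↭ (swap _ _ ↭-refl)

  swap₁₂ : I (x ∷ y ∷ z ∷ []) → I (y ∷ x ∷ z ∷ [])
  swap₁₂ = I-↭ (swap _ _ ↭-refl)

  swap₂₃ : I (x ∷ y ∷ z ∷ []) → I (x ∷ z ∷ y ∷ [])
  swap₂₃ = I-↭ (prep _ (swap _ _ ↭-refl))

  rotate : I (x ∷ y ∷ z ∷ []) → I (y ∷ z ∷ x ∷ [])
  rotate = swap₂₃ ∘ swap₁₂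

  I₁₂ : I (x ∷ y ∷ z ∷ []) → I (x ∷ y ∷ [])
  I₁₂ = I-tail ∘ rotate ∘ rotate

  I₁₃ : I (x ∷ y ∷ z ∷ []) → I (x ∷ z ∷ [])
  I₁₃ = I-tail ∘ swap₁₂

  I-≢ : I (x ∷ y ∷ []) → x ≢ y
  I-≢ ((x≢y ∷ _) ∷ _ , _) = x≢y

  -- Nonloops are parallel to themselves, as I (x ∷ x ∷ []) fails.
  Par : Fin n → Fin n → Set
  Par x y = I (x ∷ []) × I (y ∷ []) × ¬ I (x ∷ y ∷ [])

  Par? : ∀ x y → Dec (Par x y)
  Par? x y = I? (x ∷ []) ×-dec I? (y ∷ []) ×-dec ¬? (I? (x ∷ y ∷ []))

  Par-refl : I (x ∷ []) → Par x x
  Par-refl i = i , i , λ j → I-≢ j refl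

  Par-sym : Par x y → Par y x
  Par-sym (i , j , ¬k) = j , i , ¬k ∘ flip₂

  Par-trans : Par x y → Par y z → Par x z
  Par-trans (i , j , ¬k) (_ , j′ , ¬k′) = i , j′ , λ l → case aug₁₂ j l of λ
    { (inj₁ p) → ¬k p
    ; (inj₂ p) → ¬k′ (flip₂ p)
    }

  -- First `r` extends by `y` or `z`, and this pair then extends by a member of the given triple.
  -- That is neither `x`, which is parallel to `r`, nor the member already present, so it is the
  -- missing one.
  exchange : Par x r → I (x ∷ y ∷ z ∷ []) → I (r ∷ y ∷ z ∷ [])
  exchange (_ , ir , ¬xr) i with aug₁₂ ir (I-tail i)
  ... | inj₁ yr with aug₂₃ yr i
  ...   | inj₁ j        = contradiction (I₁₃ j) ¬xr
  ...   | inj₂ (inj₁ j) = contradiction refl (I-≢ (I₁₂ j))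
  ...   | inj₂ (inj₂ j) = swap₁₂ (rotate j)
  exchange (_ , ir , ¬xr) i | inj₂ zr with aug₂₃ zr i
  ...   | inj₁ j        = contradiction (I₁₃ j) ¬xr
  ...   | inj₂ (inj₁ j) = rotate (rotate j)
  ...   | inj₂ (inj₂ j) = contradiction refl (I-≢ (I₁₂ j))

-- Representatives of parallel classes, triangles and the line space

module Triangles {n : ℕ} (M : Matroid n) where
  open Independence M public

  Rep : Fin n → Set
  Rep r = I (r ∷ []) × ¬ (∃[ y ] y Fin.< r × Par y r)

  Rep? : ∀ r → Dec (Rep r)
  Rep? r = I? (r ∷ []) ×-dec ¬? (any? (λ y → (y <ᶠ? r) ×-dec Par? y r))

  -- Loops have no representative, so this relation also records which elements are loops.
  RepOf : Fin n → Fin n → Set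
  RepOf x r = Par x r × Rep r

  RepOf? : ∀ x r → Dec (RepOf x r)
  RepOf? x r = Par? x r ×-dec Rep? r

  rep : ∀ {x} → I (x ∷ []) → ∃[ r ] RepOf x r
  rep {x} i = descend (toℕ x) ≤-refl (Par-refl i)
    where
    descend : ∀ k {r} → toℕ r ≤ k → Par x r → ∃[ r ] RepOf x r
    descend k {r} r≤k p with any? (λ y → (y <ᶠ? r) ×-dec Par? y r)
    ... | no least = r , p , proj₁ (proj₂ p) , least
    descend zero    r≤k p | yes (y , y<r , _) = contradiction (≤-trans y<r r≤k) λ ()
    descend (suc k) r≤k p | yes (y , y<r , q) =
      descend k (≤-pred (≤-trans y<r r≤k)) (Par-trans p (Par-sym q))

  parallel-reps : ∀ {r s} → Rep r → Rep s → Par r s → r ≡ s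
  parallel-reps {r} {s} (_ , least) (_ , least′) p with <ᶠ-cmp r s
  ... | tri≈ _ r≡s _ = r≡s
  ... | tri< r<s _ _ = contradiction (r , r<s , p) least′
  ... | tri> _ _ s<r = contradiction (s , s<r , Par-sym p) least

  RepOf-unique : ∀ {x r s} → RepOf x r → RepOf x s → r ≡ s
  RepOf-unique (p , rep-r) (q , rep-s) = parallel-reps rep-r rep-s (Par-trans (Par-sym p) q)

  distinct-reps : ∀ {r s} → Rep r → Rep s → r ≢ s → I (r ∷ s ∷ [])
  distinct-reps {r} {s} rep-r rep-s r≢s = decidable-stable (I? (r ∷ s ∷ [])) (λ ¬i →
    r≢s (parallel-reps rep-r rep-s (proj₁ rep-r , proj₁ rep-s , ¬i)))

  -- a, c, e are the corners of a triangle, and b, d, f further points on its sides.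
  Triangle : Fin n → Fin n → Fin n → Fin n → Fin n → Fin n → Set
  Triangle a b c d e f =
    I (a ∷ c ∷ e ∷ []) × ¬ I (a ∷ b ∷ c ∷ []) × ¬ I (c ∷ d ∷ e ∷ []) × ¬ I (e ∷ f ∷ a ∷ []) ×
    I (a ∷ b ∷ []) × I (b ∷ c ∷ []) × I (c ∷ d ∷ []) × I (d ∷ e ∷ []) × I (e ∷ f ∷ []) × I (f ∷ a ∷ [])

  HasTriangle : Set
  HasTriangle = ∃[ a ] ∃[ b ] ∃[ c ] ∃[ d ] ∃[ e ] ∃[ f ] Triangle a b c d e f

  hasTriangle? : Dec HasTriangle
  hasTriangle? = any? λ a → any? λ b → any? λ c → any? λ d → any? λ e → any? λ f →
    I? (a ∷ c ∷ e ∷ []) ×-dec ¬? (I? (a ∷ b ∷ c ∷ [])) ×-dec ¬? (I? (c ∷ d ∷ e ∷ [])) ×-dec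
    ¬? (I? (e ∷ f ∷ a ∷ [])) ×-dec I? (a ∷ b ∷ []) ×-dec I? (b ∷ c ∷ []) ×-dec I? (c ∷ d ∷ []) ×-dec
    I? (d ∷ e ∷ []) ×-dec I? (e ∷ f ∷ []) ×-dec I? (f ∷ a ∷ [])

  Collinear : Fin n → Fin n → Fin n → Set
  Collinear x y z = (Rep x × Rep y × Rep z) × (I (x ∷ y ∷ []) × I (x ∷ z ∷ []) × I (y ∷ z ∷ [])) ×
    ¬ I (x ∷ y ∷ z ∷ [])

  Collinear? : ∀ x y z → Dec (Collinear x y z)
  Collinear? x y z = (Rep? x ×-dec Rep? y ×-dec Rep? z) ×-dec
    (I? (x ∷ y ∷ []) ×-dec I? (x ∷ z ∷ []) ×-dec I? (y ∷ z ∷ [])) ×-dec ¬? (I? (x ∷ y ∷ z ∷ []))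

  -- The axiom `triangle` is the absence of triangles: if `x`, `y`, `z` were independent, they would
  -- be the corners of one with `u`, `v`, `w` on its sides.
  lineSpace : ¬ HasTriangle → LineSpace n
  lineSpace noTriangle = record
    { L        = Collinear
    ; L?       = Collinear?
    ; swap₁₂   = λ ((rx , ry , rz) , (xy , xz , yz) , ¬xyz) → (ry , rx , rz) , (flip₂ xy , yz , xz) , ¬xyz ∘ swap₁₂
    ; swap₂₃   = λ ((rx , ry , rz) , (xy , xz , yz) , ¬xyz) → (rx , rz , ry) , (xz , xy , flip₂ yz) , ¬xyz ∘ swap₂₃
    ; distinct = λ (_ , (xy , _) , _) → I-≢ xy
    ; L-trans  = L-trans
    ; triangle = λ {x} {y} {z} {u} {v} {w}
        ((rx , ry , _) , (xy , xu , yu) , ¬xyu) ((_ , rz , _) , (yz , yv , zv) , ¬yzv) (_ , (xz , xw , zw) , ¬xzw) →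
        (rx , ry , rz) , (xy , xz , yz) , λ xyz → noTriangle (x , u , y , v , z , w ,
          xyz , ¬xyu ∘ swap₂₃ , ¬yzv ∘ swap₂₃ , ¬xzw ∘ rotate ∘ rotate ,
          xu , flip₂ yu , yv , flip₂ zv , zw , flip₂ xw)
    }
    where
    L-trans : ∀ {x y z w} → Collinear x y z → Collinear x y w → z ≢ w → Collinear x z w
    L-trans {x} {y} {z} {w} ((rx , _ , rz) , (xy , xz , _) , ¬xyz) ((_ , _ , rw) , (_ , xw , _) , ¬xyw) z≢w =
      (rx , rz , rw) , (xz , xw , distinct-reps rz rw z≢w) , ¬xzw
      where
      -- Augmenting `x`, `y` from an independent `x`, `z`, `w` would make one of the two given
      -- triples independent.
      ¬xzw : ¬ I (x ∷ z ∷ w ∷ [])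
      ¬xzw i with aug₂₃ xy i
      ... | inj₁ j        = I-≢ (I₁₂ j) refl
      ... | inj₂ (inj₁ j) = ¬xyz (rotate j)
      ... | inj₂ (inj₂ j) = ¬xyw (rotate j)

-- Recovering the matroid from representatives and collinear triples

module _ {n : ℕ} (M M′ : Matroid n) where
  private
    module M  = Triangles M
    module M′ = Triangles M′

  module _ (I⇒∣∣≤3 : ∀ xs → M.I xs → length xs ≤ 3)
           (RepOf⊆ : ∀ {x r} → M.RepOf x r → M′.RepOf x r)
           (Collinear⊇ : ∀ {x y z} → M′.Collinear x y z → M.Collinear x y z) where

    I₁⊆ : ∀ {x} → M.I (x ∷ []) → M′.I (x ∷ [])
    I₁⊆ i = proj₁ (proj₁ (RepOf⊆ (proj₂ (M.rep i))))

    -- If `x` and `y` were parallel in `M′`, their representatives in `M`, which represent them in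
    -- `M′` too, would coincide, and `x` and `y` would be parallel in `M`.
    I₂⊆ : ∀ {x y} → M.I (x ∷ y ∷ []) → M′.I (x ∷ y ∷ [])
    I₂⊆ {x} {y} i = decidable-stable (M′.I? (x ∷ y ∷ [])) λ ¬i′ →
      let ix = M.I-tail (M.flip₂ i)
          iy = M.I-tail i
          r , x-r = M.rep ix
          s , y-s = M.rep iy
          r≡s = M′.parallel-reps (proj₂ (RepOf⊆ x-r)) (proj₂ (RepOf⊆ y-s))
            (M′.Par-trans (M′.Par-sym (proj₁ (RepOf⊆ x-r)))
              (M′.Par-trans (I₁⊆ ix , I₁⊆ iy , ¬i′) (proj₁ (RepOf⊆ y-s))))
      in proj₂ (proj₂ (M.Par-trans (proj₁ x-r) (M.Par-sym (subst (M.Par y) (sym r≡s) (proj₁ y-s))))) i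

    -- By `exchange` the triple may be replaced by its representatives in both matroids. These are
    -- pairwise independent in `M′` by `I₂⊆`, so if dependent there they are collinear, hence
    -- dependent in `M`. This is why the inclusion of `Collinear` runs opposite to that of `RepOf`.
    I₃⊆ : ∀ {x y z} → M.I (x ∷ y ∷ z ∷ []) → M′.I (x ∷ y ∷ z ∷ [])
    I₃⊆ {x} {y} {z} i = decidable-stable (M′.I? (x ∷ y ∷ z ∷ [])) λ ¬i′ →
      let r , x-r = M.rep (M.I-tail (M.flip₂ (M.I₁₂ i)))
          s , y-s = M.rep (M.I-tail (M.I₁₂ i))
          u , z-u = M.rep (M.I-tail (M.I-tail i))
          rsu = M.rotate (M.exchange (proj₁ z-u) (M.rotate (M.exchange (proj₁ y-s) (M.rotate (M.exchange (proj₁ x-r) i)))))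
          ¬rsu′ = λ j → ¬i′ (M′.rotate (M′.exchange (M′.Par-sym (proj₁ (RepOf⊆ z-u)))
                    (M′.rotate (M′.exchange (M′.Par-sym (proj₁ (RepOf⊆ y-s)))
                    (M′.rotate (M′.exchange (M′.Par-sym (proj₁ (RepOf⊆ x-r))) j))))))
          _ , _ , ¬rsu = Collinear⊇ ((proj₂ (RepOf⊆ x-r) , proj₂ (RepOf⊆ y-s) , proj₂ (RepOf⊆ z-u)) ,
            (I₂⊆ (M.I₁₂ rsu) , I₂⊆ (M.I₁₃ rsu) , I₂⊆ (M.I-tail rsu)) , ¬rsu′)
      in ¬rsu rsu

    Indep⊆ : ∀ X → Indep M X → Indep M′ X
    Indep⊆ X i = subst (Indep M′) (fromList-elements X) (proj₂ (I⊆ (elements X)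
      (elements-unique X , subst (Indep M) (sym (fromList-elements X)) i)))
      where
      I⊆ : ∀ xs → M.I xs → M′.I xs
      I⊆ []                  _ = [] , ∅-indep M′
      I⊆ (_ ∷ [])            i = I₁⊆ i
      I⊆ (_ ∷ _ ∷ [])        i = I₂⊆ i
      I⊆ (_ ∷ _ ∷ _ ∷ [])    i = I₃⊆ i
      I⊆ xs@(_ ∷ _ ∷ _ ∷ _ ∷ _) i = contradiction (I⇒∣∣≤3 xs i) λ { (s≤s (s≤s (s≤s ()))) }

-- Minors

open Equivalence using (to; from)

image : (Fin k → Fin n) → Subset k → Subset n
image v Y = fromList (map v (elements Y))

module _ {v : Fin k → Fin n} where

  ∈-image⁺ : ∀ {Y i} → i ∈ Y → v i ∈ image v Y
  ∈-image⁺ i∈ = ∈-fromList⁺ (∈-map⁺ v (∈-elements⁺ i∈))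

  ∈-image⁻ : ∀ {Y x} → x ∈ image v Y → ∃[ i ] i ∈ Y × x ≡ v i
  ∈-image⁻ {Y} x∈ with ∈-map⁻ v (∈-fromList⁻ _ x∈)
  ... | i , i∈ , x≡ = i , ∈-elements⁻ Y i∈ , x≡

  ∣image∣ : (∀ {i j} → v i ≡ v j → i ≡ j) → ∀ Y → ∣ image v Y ∣ ≡ ∣ Y ∣
  ∣image∣ inj Y = trans (∣fromList∣ (Uniqueₚ.map⁺ inj (elements-unique Y)))
    (trans (length-map v (elements Y)) (∣elements∣ Y))

-- If the ground set of `N` is full, this is a restriction of `M` isomorphic to `N`, given by an
-- injection in place of deleted and contracted sets.
record Embedding (N : Matroid k) (M : Matroid n) : Set where
  field
    map⟨_⟩    : Fin k → Fin n
    injective : ∀ {i j} → map⟨_⟩ i ≡ map⟨_⟩ j → i ≡ j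
    indep⇔    : ∀ Y → Indep M (image map⟨_⟩ Y) ⇔ Indep N Y

rank-≤ : (M : Matroid n) {r : ℕ} → HasRank M r → ∀ {X} → Indep M X → ∣ X ∣ ≤ r
rank-≤ M (_ , b , refl) i = basis-≤ M b (indep⊆ground M i) i

∣p∣≡0⇒x∉p : ∀ {p : Subset n} {x} → ∣ p ∣ ≡ 0 → x ∉ p
∣p∣≡0⇒x∉p {p = p} {x} eq x∈ = contradiction
  (≤-trans (≤-reflexive (sym (∣⁅x⁆∣≡1 x))) (≤-trans (p⊆q⇒∣p∣≤∣q∣ (⁅⁆⊆ x∈)) (≤-reflexive eq))) λ ()

Element-≡ : (M : Matroid n) {x y : Element M} → proj₁ x ≡ proj₁ y → x ≡ y
Element-≡ M {x , p} {.x , q} refl = cong (x ,_) ([]=-irrelevant p q)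

module _ (N : Matroid k) (M : Matroid n) where

  -- An independent set of `N` as large as the rank of `M` leaves no rank to contract, so the minor
  -- is a restriction.
  minor⇒embedding : ∀ {r} → HasRank M r → (∀ {i} → i ∈ ground N) → (∃[ Y ] Indep N Y × ∣ Y ∣ ≡ r) →
    HasMinor M N → Embedding N M
  minor⇒embedding {r} rankM full (Y₀ , iY₀ , ∣Y₀∣) (C , D , _ , _ , _ , iso) = record
    { map⟨_⟩ = v ; injective = injective
    ; indep⇔ = λ Y → mk⇔ (to (preserved Y) ∘ toMinor Y) (fromMinor ∘ from (preserved Y)) }
    where
    M′ = (M ／ C) ∖ D
    open _≅_ iso
    f : Element M′ → Element N
    f = Inverse.to bijection
    g : Fin k → Element M′
    g i = Inverse.from bijection (i , full)
    v : Fin k → Fin n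
    v i = proj₁ (g i)

    fg : ∀ i → proj₁ (f (g i)) ≡ i
    fg i = cong proj₁ (Inverse.strictlyInverseˡ bijection (i , full))

    gf : ∀ e → v (proj₁ (f e)) ≡ proj₁ e
    gf e with f e in eq
    ... | i , i∈ = trans (cong (λ j → proj₁ (Inverse.from bijection (i , j))) ([]=-irrelevant full i∈))
      (trans (cong (proj₁ ∘ Inverse.from bijection) (sym eq)) (cong proj₁ (Inverse.strictlyInverseʳ bijection e)))

    injective : ∀ {i j} → v i ≡ v j → i ≡ j
    injective {i} {j} eq = trans (sym (fg i)) (trans (cong (proj₁ ∘ f) (Element-≡ M′ eq)) (fg j))

    image⊆ : ∀ Y → image v Y ⊆ ground M′
    image⊆ Y x∈ with ∈-image⁻ {v = v} {Y = Y} x∈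
    ... | i , _ , refl = proj₂ (g i)

    preserved : ∀ Y → Indep M′ (image v Y) ⇔ Indep N Y
    preserved Y = preserves (image⊆ Y) (λ _ → full) λ e → mk⇔ (forth e)
      (λ fe∈ → subst (_∈ image v Y) (gf e) (∈-image⁺ {v = v} fe∈))
      where
      forth : ∀ e → proj₁ e ∈ image v Y → proj₁ (f e) ∈ Y
      forth e e∈ with ∈-image⁻ {v = v} e∈
      ... | i , i∈ , eq = subst (_∈ Y) (trans (sym (fg i)) (cong (proj₁ ∘ f) (Element-≡ M′ (sym eq)))) i∈

    fromMinor : ∀ {X} → Indep M′ X → Indep M X
    fromMinor (_ , _ , B , _ , i) = hereditary M i (p⊆p∪q B)

    -- As M′ has the same rank as M, all elements of C are loops.
    loops : ∃[ B ] IsBasisOf M C B × ∣ B ∣ ≡ 0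
    loops with from (preserved Y₀) iY₀
    ... | Z⊆ , Z⊆′ , B , b , i = B , b , n≤0⇒n≡0 (+-cancelˡ-≤ r ∣ B ∣ 0 (begin
      r + ∣ B ∣                       ≡⟨ cong (_+ ∣ B ∣) (trans (∣image∣ injective Y₀) ∣Y₀∣) ⟨
      ∣ image v Y₀ ∣ + ∣ B ∣          ≡⟨ ∣∪∣-disjoint (image v Y₀) B (λ x∈ x∈B →
                                          x∈p─q⇒x∉q (ground M) C (Z⊆′ x∈) (B⊆T b x∈B)) ⟨
      ∣ image v Y₀ ∪ B ∣              ≤⟨ rank-≤ M rankM i ⟩
      r                               ≡⟨ +-identityʳ r ⟨
      r + 0                           ∎))
      where open ≤-Reasoning

    toMinor : ∀ Y → Indep M (image v Y) → Indep M′ (image v Y)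
    toMinor Y i with loops
    ... | B , b , ∣B∣≡0 = image⊆ Y , p─q⊆p _ D ∘ image⊆ Y , B , b ,
      hereditary M i (∪-lub id (λ x∈B → contradiction x∈B (∣p∣≡0⇒x∉p ∣B∣≡0)))

  -- Contract the empty set, whose basis is empty, and delete the complement of the image.
  embedding⇒minor : (∀ {x} → x ∈ ground M) → (∀ {i} → i ∈ ground N) → Embedding N M → HasMinor M N
  embedding⇒minor fullM fullN emb = ⊥ , ∁ V , ⊥⊆ , (λ _ → fullM) , (λ (_ , x∈) → ∉⊥ (proj₁ (x∈p∩q⁻ ⊥ (∁ V) x∈))) , record
    { bijection = mk↔ₛ′ f g fg gf
    ; preserves = λ {X} {Y} X⊆ _ X⇔Y → subst (λ Z → Indep M′ Z ⇔ Indep N Y) (sym (X≡image X⊆ X⇔Y))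
        (mk⇔ (to (indep⇔ Y) ∘ fromMinor) (toMinor (subst (_⊆ ground M′) (X≡image X⊆ X⇔Y) X⊆) ∘ from (indep⇔ Y)))
    }
    where
    open Embedding emb renaming (map⟨_⟩ to v)
    V = image v ⊤
    M′ = (M ／ ⊥) ∖ ∁ V

    v∈ : ∀ i → v i ∈ ground M′
    v∈ i = x∈p∧x∉q⇒x∈p─q (x∈p∧x∉q⇒x∈p─q fullM ∉⊥) (x∈p⇒x∉∁p (∈-image⁺ {v = v} ∈⊤))

    preimage : (e : Element M′) → ∃[ i ] i ∈ ⊤ × proj₁ e ≡ v i
    preimage (x , x∈) = ∈-image⁻ (x∉∁p⇒x∈p (x∈p─q⇒x∉q _ (∁ V) x∈))

    f : Element M′ → Element N
    f e = proj₁ (preimage e) , fullN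

    g : Element N → Element M′
    g (i , _) = v i , v∈ i

    fg : ∀ e → f (g e) ≡ e
    fg e = Element-≡ N (injective (sym (proj₂ (proj₂ (preimage (g e))))))

    gf : ∀ e → g (f e) ≡ e
    gf e = Element-≡ M′ (sym (proj₂ (proj₂ (preimage e))))

    X≡image : ∀ {X Y} → X ⊆ ground M′ → (∀ e → proj₁ e ∈ X ⇔ proj₁ (f e) ∈ Y) → X ≡ image v Y
    X≡image {X} {Y} X⊆ X⇔Y = ⊆-antisym forth back
      where
      forth : X ⊆ image v Y
      forth {x} x∈ = subst (_∈ image v Y) (cong proj₁ (gf (x , X⊆ x∈))) (∈-image⁺ (to (X⇔Y (x , X⊆ x∈)) x∈))
      back : image v Y ⊆ X
      back x∈ with ∈-image⁻ {v = v} x∈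
      ... | i , i∈ , refl = from (X⇔Y (g (i , fullN))) (subst (λ e → proj₁ e ∈ Y) (sym (fg (i , fullN))) i∈)

    fromMinor : ∀ {X} → Indep M′ X → Indep M X
    fromMinor (_ , _ , B , _ , i) = hereditary M i (p⊆p∪q B)

    toMinor : ∀ {X} → X ⊆ ground M′ → Indep M X → Indep M′ X
    toMinor X⊆ i with basis M ⊥
    ... | B , b = X⊆ , p─q⊆p _ (∁ V) ∘ X⊆ , B , b ,
      hereditary M i (∪-lub id (λ x∈B → contradiction (B⊆T b x∈B) ∉⊥))

-- Triangles and the two excluded matroids

-- The points a, …, f of 𝒲³ and M[K₄] are numbered 0, …, 5.
lines₃ lines₄ : List (Subset 6)
lines₃ = fromList (# 0 ∷ # 1 ∷ # 2 ∷ []) ∷ fromList (# 2 ∷ # 3 ∷ # 4 ∷ []) ∷ fromList (# 4 ∷ # 5 ∷ # 0 ∷ []) ∷ []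
lines₄ = lines₃ ++ fromList (# 1 ∷ # 3 ∷ # 5 ∷ []) ∷ []

-- After the corners, each row of `bases₄` is an orbit of the rotation by two places modulo 6, in
-- the order in which `triangle-bases` supplies it. There are 16 triples in all, the 20 triples less
-- the four lines of M(K₄).
bases₄ bases₃ : List (List (Fin 6))
bases₄ =
  (# 0 ∷ # 2 ∷ # 4 ∷ []) ∷
  (# 0 ∷ # 2 ∷ # 3 ∷ []) ∷ (# 2 ∷ # 4 ∷ # 5 ∷ []) ∷ (# 4 ∷ # 0 ∷ # 1 ∷ []) ∷
  (# 0 ∷ # 2 ∷ # 5 ∷ []) ∷ (# 2 ∷ # 4 ∷ # 1 ∷ []) ∷ (# 4 ∷ # 0 ∷ # 3 ∷ []) ∷
  (# 0 ∷ # 1 ∷ # 3 ∷ []) ∷ (# 2 ∷ # 3 ∷ # 5 ∷ []) ∷ (# 4 ∷ # 5 ∷ # 1 ∷ []) ∷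
  (# 0 ∷ # 1 ∷ # 5 ∷ []) ∷ (# 2 ∷ # 3 ∷ # 1 ∷ []) ∷ (# 4 ∷ # 5 ∷ # 3 ∷ []) ∷
  (# 0 ∷ # 3 ∷ # 5 ∷ []) ∷ (# 2 ∷ # 5 ∷ # 1 ∷ []) ∷ (# 4 ∷ # 1 ∷ # 3 ∷ []) ∷ []
bases₃ = (# 1 ∷ # 3 ∷ # 5 ∷ []) ∷ bases₄

Spanned : List (Subset 6) → List (List (Fin 6)) → Set
Spanned lines bases = ∀ Y → IndepAvoiding lines Y → Any (λ b → Y ⊆ fromList b) bases

spanned? : ∀ lines bases → Dec (Spanned lines bases)
spanned? lines bases = allSubset? (λ Y → indepAvoiding? lines Y →-dec Any.any? (λ b → Y ⊆? fromList b) bases)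

spanned₃ : Spanned lines₃ bases₃
spanned₃ = from-yes (spanned? lines₃ bases₃)

spanned₄ : Spanned lines₄ bases₄
spanned₄ = from-yes (spanned? lines₄ bases₄)

module _ (M : Matroid n) where
  open Triangles M

  private
    variable
      a b c d e f : Fin n

  -- Large sets are dependent by the rank and lines by the last hypothesis; any other set lies in a
  -- listed basis, whose image is independent.
  sixElementEmbedding : (∀ {X} → Indep M X → ∣ X ∣ ≤ 3) →
    {N : Matroid 6} {lines : List (Subset 6)} → (∀ {Y} → Indep N Y ⇔ IndepAvoiding lines Y) →
    {bases : List (List (Fin 6))} → Spanned lines bases →
    {v : Vec (Fin n) 6} → VecUnique v → All (λ b → I (map (Vec.lookup v) b)) bases →
    All (λ ℓ → ¬ Indep M (image (Vec.lookup v) ℓ)) lines → Embedding N M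
  sixElementEmbedding rank≤3 indepN spanned {v} unique indep dep = record
    { map⟨_⟩    = Vec.lookup v
    ; injective = λ {i} {j} → Vec-lookup-injective unique i j
    ; indep⇔    = λ Y → mk⇔
        (λ i → from indepN (≤-trans (≤-reflexive (sym (∣image∣ {v = Vec.lookup v} (λ {i} {j} → Vec-lookup-injective unique i j) Y))) (rank≤3 i) ,
               λ Y∈ → All.lookup dep Y∈ i))
        (λ iY → spanned⇒indep indep (spanned Y (to indepN iY)))
    }
    where
    image⊆ : ∀ {Y b} → Y ⊆ fromList b → image (Vec.lookup v) Y ⊆ fromList (map (Vec.lookup v) b)
    image⊆ {Y} {b} Y⊆ x∈ with ∈-image⁻ {v = Vec.lookup v} {Y = Y} x∈
    ... | i , i∈ , refl = ∈-fromList⁺ (∈-map⁺ (Vec.lookup v) (∈-fromList⁻ b (Y⊆ i∈)))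

    spanned⇒indep : ∀ {Y bs} → All (λ b → I (map (Vec.lookup v) b)) bs → Any (λ b → Y ⊆ fromList b) bs →
      Indep M (image (Vec.lookup v) Y)
    spanned⇒indep {Y} {b ∷ _} ((_ , i) ∷ _) (here Y⊆)  = hereditary M i (image⊆ {Y} {b} Y⊆)
    spanned⇒indep {Y} (_ ∷ is)      (there Y⊆) = spanned⇒indep {Y} is Y⊆

  -- By this symmetry of order three, one triple from each orbit in `bases₄` has to be treated.
  turn : Triangle a b c d e f → Triangle c d e f a b
  turn (ace , ¬abc , ¬cde , ¬efa , ab , bc , cd , de , ef , fa) =
    rotate ace , ¬cde , ¬efa , ¬abc , cd , de , ef , fa , ab , bc

  -- Here and in the next four lemmas an independent pair is augmented from an independent triple.
  -- Of the three candidates one is already present and one would make a side of the triangle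
  -- independent, which leaves the third.
  triangle-acd : Triangle a b c d e f → I (a ∷ c ∷ d ∷ [])
  triangle-acd (ace , ¬abc , ¬cde , ¬efa , ab , bc , cd , de , ef , fa) with aug₂₃ cd ace
  ... | inj₁ i        = i
  ... | inj₂ (inj₁ i) = contradiction refl (I-≢ (I₁₂ i))
  ... | inj₂ (inj₂ i) = contradiction (rotate i) ¬cde

  triangle-acf : Triangle a b c d e f → I (a ∷ c ∷ f ∷ [])
  triangle-acf (ace , ¬abc , ¬cde , ¬efa , ab , bc , cd , de , ef , fa) with aug₂₃ fa ace
  ... | inj₁ i        = contradiction refl (I-≢ (I₁₃ i))
  ... | inj₂ (inj₁ i) = rotate (rotate i)
  ... | inj₂ (inj₂ i) = contradiction i ¬efa

  triangle-abd : Triangle a b c d e f → I (a ∷ b ∷ d ∷ [])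
  triangle-abd T@(ace , ¬abc , ¬cde , ¬efa , ab , bc , cd , de , ef , fa) with aug₂₃ ab (triangle-acd T)
  ... | inj₁ i        = contradiction refl (I-≢ (I₁₂ i))
  ... | inj₂ (inj₁ i) = contradiction (rotate i) ¬abc
  ... | inj₂ (inj₂ i) = rotate i

  triangle-abf : Triangle a b c d e f → I (a ∷ b ∷ f ∷ [])
  triangle-abf T@(ace , ¬abc , ¬cde , ¬efa , ab , bc , cd , de , ef , fa) with aug₂₃ ab (triangle-acf T)
  ... | inj₁ i        = contradiction refl (I-≢ (I₁₂ i))
  ... | inj₂ (inj₁ i) = contradiction (rotate i) ¬abc
  ... | inj₂ (inj₂ i) = rotate i

  triangle-adf : Triangle a b c d e f → I (a ∷ d ∷ f ∷ [])
  triangle-adf {a} {b} {c} {d} {e} {f} T@(ace , ¬abc , ¬cde , ¬efa , ab , bc , cd , de , ef , fa) with aug₂₃ fa (triangle-acf {a = e} {b = f} {c = a} {d = b} {e = c} {f = d} (turn (turn T)))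
  ... | inj₁ i        = contradiction i ¬efa
  ... | inj₂ (inj₁ i) = contradiction refl (I-≢ (I₁₃ i))
  ... | inj₂ (inj₂ i) = rotate (rotate i)

  module _ (T : Triangle a b c d e f) where
    private
      T′ = turn T
      T″ = turn T′
      corners = proj₁ T
      pairs = proj₂ (proj₂ (proj₂ (proj₂ T)))

    triangle-points : Vec (Fin n) 6
    triangle-points = a ∷ b ∷ c ∷ d ∷ e ∷ f ∷ []

    triangle-bases : All (λ b → I (map (Vec.lookup triangle-points) b)) bases₄
    triangle-bases =
      corners ∷
      triangle-acd T ∷ triangle-acd T′ ∷ triangle-acd T″ ∷
      triangle-acf T ∷ triangle-acf T′ ∷ triangle-acf T″ ∷
      triangle-abd T ∷ triangle-abd T′ ∷ triangle-abd T″ ∷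
      triangle-abf T ∷ triangle-abf T′ ∷ triangle-abf T″ ∷
      triangle-adf T ∷ triangle-adf T′ ∷ triangle-adf T″ ∷ []

    triangle-unique : VecUnique triangle-points
    triangle-unique =
      (I-≢ ab ∷ I-≢ (I₁₂ ace) ∷ I-≢ (I₁₃ (triangle-acd T)) ∷ I-≢ (I₁₃ ace) ∷ ≢-sym (I-≢ fa) ∷ []) ∷
      (I-≢ bc ∷ I-≢ (I-tail (triangle-abd T)) ∷ ≢-sym (I-≢ (I₁₃ (triangle-acd T″))) ∷ I-≢ (I-tail (triangle-abf T)) ∷ []) ∷
      (I-≢ cd ∷ I-≢ (I-tail ace) ∷ I-≢ (I-tail (triangle-acf T)) ∷ []) ∷
      (I-≢ de ∷ I-≢ (I-tail (triangle-adf T)) ∷ []) ∷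
      (I-≢ ef ∷ []) ∷ [] ∷ []
      where
      ace = corners
      ab = proj₁ pairs
      bc = proj₁ (proj₂ pairs)
      cd = proj₁ (proj₂ (proj₂ pairs))
      de = proj₁ (proj₂ (proj₂ (proj₂ pairs)))
      ef = proj₁ (proj₂ (proj₂ (proj₂ (proj₂ pairs))))
      fa = proj₂ (proj₂ (proj₂ (proj₂ (proj₂ pairs))))

    dependent : ∀ {x y z} → x ≢ y → x ≢ z → y ≢ z → ¬ I (x ∷ y ∷ z ∷ []) → ¬ Indep M (fromList (x ∷ y ∷ z ∷ []))
    dependent x≢y x≢z y≢z ¬i i = ¬i (((x≢y ∷ x≢z ∷ []) ∷ (y≢z ∷ []) ∷ [] ∷ []) , i)

    -- All triples except `b`, `d`, `f` are settled by the triangle; if this one is independent, the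
    -- points form a 𝒲³, and otherwise an M(K₄).
    triangle⇒embedding : (∀ {X} → Indep M X → ∣ X ∣ ≤ 3) → Embedding 𝒲³ M ⊎ Embedding M[K₄] M
    triangle⇒embedding rank≤3 = decide T triangle-unique (I? (b ∷ d ∷ f ∷ []))
      where
      decide : Triangle a b c d e f → VecUnique triangle-points → Dec (I (b ∷ d ∷ f ∷ [])) →
        Embedding 𝒲³ M ⊎ Embedding M[K₄] M
      decide (_ , ¬abc , ¬cde , ¬efa , _)
        ((a≢b ∷ a≢c ∷ a≢d ∷ a≢e ∷ a≢f ∷ []) ∷ (b≢c ∷ b≢d ∷ b≢e ∷ b≢f ∷ []) ∷ (c≢d ∷ c≢e ∷ c≢f ∷ []) ∷
         (d≢e ∷ d≢f ∷ []) ∷ (e≢f ∷ []) ∷ [] ∷ []) = λ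
        -- `lines₃` and `lines₄` evaluate to the lists in the definitions of `𝒲³` and `M[K₄]`, so
        -- the equivalence of independence is the identity.
        { (yes bdf) → inj₁ (sixElementEmbedding rank≤3 {𝒲³} {lines₃} (mk⇔ id id) spanned₃ triangle-unique
            (bdf ∷ triangle-bases) sides)
        ; (no ¬bdf) → inj₂ (sixElementEmbedding rank≤3 {M[K₄]} {lines₄} (mk⇔ id id) spanned₄ triangle-unique
            triangle-bases (++⁺ sides (dependent b≢d b≢f d≢f ¬bdf ∷ [])))
        }
        where
        sides : All (λ ℓ → ¬ Indep M (image (Vec.lookup triangle-points) ℓ)) lines₃
        -- `image` enumerates in increasing order, so the line through `e`, `f`, `a` appears as `a`,
        -- `e`, `f`.
        sides = dependent a≢b a≢c b≢c ¬abc ∷ dependent c≢d c≢e d≢e ¬cde ∷ dependent a≢e a≢f e≢f (¬efa ∘ rotate) ∷ []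

  -- The entries increase, so that `elements` returns each list by evaluation.
  independent-lists : List (List (Fin 6))
  independent-lists = (# 0 ∷ # 2 ∷ # 4 ∷ []) ∷ (# 0 ∷ # 1 ∷ []) ∷ (# 1 ∷ # 2 ∷ []) ∷ (# 2 ∷ # 3 ∷ []) ∷
    (# 3 ∷ # 4 ∷ []) ∷ (# 4 ∷ # 5 ∷ []) ∷ (# 0 ∷ # 5 ∷ []) ∷ []

  -- Only properties common to 𝒲³ and M(K₄) are assumed of `N`, so that one proof serves both.
  embedding⇒triangle : {N : Matroid 6} → Embedding N M →
    All (λ xs → Indep N (fromList xs)) independent-lists → All (λ ℓ → ¬ Indep N ℓ) lines₃ → HasTriangle
  embedding⇒triangle {N} emb (ace ∷ ab ∷ bc ∷ cd ∷ de ∷ ef ∷ af ∷ []) (¬abc ∷ ¬cde ∷ ¬aef ∷ []) =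
    v (# 0) , v (# 1) , v (# 2) , v (# 3) , v (# 4) , v (# 5) ,
    independent (# 0 ∷ # 2 ∷ # 4 ∷ []) refl ace ,
    (λ i → ¬abc (to (indep⇔ _) (proj₂ i))) , (λ i → ¬cde (to (indep⇔ _) (proj₂ i))) ,
    (λ i → ¬aef (to (indep⇔ _) (proj₂ (rotate (rotate i))))) ,
    independent (# 0 ∷ # 1 ∷ []) refl ab , independent (# 1 ∷ # 2 ∷ []) refl bc ,
    independent (# 2 ∷ # 3 ∷ []) refl cd , independent (# 3 ∷ # 4 ∷ []) refl de ,
    independent (# 4 ∷ # 5 ∷ []) refl ef , flip₂ (independent (# 0 ∷ # 5 ∷ []) refl af)
    where
    open Embedding emb renaming (map⟨_⟩ to v)
    independent : ∀ xs → elements (fromList xs) ≡ xs → Indep N (fromList xs) → I (map v xs)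
    independent xs eq i = Uniqueₚ.map⁺ injective (subst Unique eq (elements-unique (fromList xs))) ,
      subst (λ ys → Indep M (fromList (map v ys))) eq (from (indep⇔ (fromList xs)) i)

  noTriangle⇔noMinor : (∀ {x} → x ∈ ground M) → HasRank M 3 →
    (¬ HasTriangle) ⇔ (¬ HasMinor M 𝒲³ × ¬ HasMinor M M[K₄])
  noTriangle⇔noMinor full rank = mk⇔
    (λ noTriangle →
      (λ minor → noTriangle (embedding⇒triangle
        (minor⇒embedding 𝒲³ M rank ∈⊤ (ace , from-yes (indep? 𝒲³ ace) , refl) minor)
        (from-yes (All.all? (λ xs → indep? 𝒲³ (fromList xs)) independent-lists))
        (from-yes (All.all? (λ ℓ → ¬? (indep? 𝒲³ ℓ)) lines₃)))) ,
      (λ minor → noTriangle (embedding⇒triangle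
        (minor⇒embedding M[K₄] M rank ∈⊤ (ace , from-yes (indep? M[K₄] ace) , refl) minor)
        (from-yes (All.all? (λ xs → indep? M[K₄] (fromList xs)) independent-lists))
        (from-yes (All.all? (λ ℓ → ¬? (indep? M[K₄] ℓ)) lines₃)))))
    (λ (no-𝒲³ , no-M[K₄]) (a , b , c , d , e , f , T) →
      [ no-𝒲³ ∘ embedding⇒minor 𝒲³ M full ∈⊤ , no-M[K₄] ∘ embedding⇒minor M[K₄] M full ∈⊤ ]′
        (triangle⇒embedding T (rank-≤ M rank)))
    where
    ace = fromList (# 0 ∷ # 2 ∷ # 4 ∷ [])

-- Enumeration

open Rank3Excluding𝒲³,M[K₄]

_≐_ : Matroid n → Matroid n → Set
M ≐ N = ∀ X → Indep M X ⇔ Indep N X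

≐-sym : {M N : Matroid n} → M ≐ N → N ≐ M
≐-sym M≐N X = mk⇔ (from (M≐N X)) (to (M≐N X))

HasRank-resp : {M N : Matroid n} → M ≐ N → ground M ≡ ⊤ → ground N ≡ ⊤ → ∀ {r} → HasRank M r → HasRank N r
HasRank-resp {M = M} {N} M≐N M⊤ N⊤ (B , b , ∣B∣) = B , record
  { B⊆T     = λ {x} _ → subst (x ∈_) (sym N⊤) ∈⊤
  ; indep   = to (M≐N B) (indep b)
  ; maximal = λ {X} _ iX → maximal b (λ {x} _ → subst (x ∈_) (sym M⊤) ∈⊤) (from (M≐N X) iX)
  } , ∣B∣

HasTriangle-resp : {M N : Matroid n} → M ≐ N → Triangles.HasTriangle M → Triangles.HasTriangle N
HasTriangle-resp {M = M} {N} M≐N (a , b , c , d , e , f , ace , ¬abc , ¬cde , ¬efa , ab , bc , cd , de , ef , fa) =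
  a , b , c , d , e , f , fwd ace , ¬abc ∘ bwd , ¬cde ∘ bwd , ¬efa ∘ bwd , fwd ab , fwd bc , fwd cd , fwd de , fwd ef , fwd fa
  where
  fwd : ∀ {xs} → Triangles.I M xs → Triangles.I N xs
  fwd {xs} (u , i) = u , to (M≐N (fromList xs)) i
  bwd : ∀ {xs} → Triangles.I N xs → Triangles.I M xs
  bwd {xs} (u , i) = u , from (M≐N (fromList xs)) i

full : (M : Rank3Excluding𝒲³,M[K₄] n) → ∀ {x} → x ∈ ground (matroid M)
full M {x} = subst (x ∈_) (sym (ground≡⊤ M)) ∈⊤

noTriangle : (M : Rank3Excluding𝒲³,M[K₄] n) → ¬ Triangles.HasTriangle (matroid M)
noTriangle M = from (noTriangle⇔noMinor (matroid M) (full M) (rank3 M)) (no-𝒲³ M , no-M[K₄] M)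

fromNoTriangle : (M : Matroid n) → ground M ≡ ⊤ → HasRank M 3 → ¬ Triangles.HasTriangle M → Rank3Excluding𝒲³,M[K₄] n
fromNoTriangle M M⊤ rank ¬T = record
  { matroid  = M
  ; ground≡⊤ = M⊤
  ; rank3    = rank
  ; no-𝒲³    = proj₁ minors
  ; no-M[K₄] = proj₂ minors
  }
  where
  minors = to (noTriangle⇔noMinor M (λ {x} → subst (x ∈_) (sym M⊤) ∈⊤) rank) ¬T

decSetoid : ℕ → DecSetoid _ _
decSetoid n = record
  { isDecEquivalence = record
    { isEquivalence = Setoid.isEquivalence (rank3Excluding𝒲³,M[K₄] n)
    ; _≟_ = λ M N → allSubset? (λ X → map′ (λ (f , g) → mk⇔ f g) (λ e → to e , from e)
        ((indep? (matroid M) X →-dec indep? (matroid N) X) ×-dec (indep? (matroid N) X →-dec indep? (matroid M) X)))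
    }
  }

module _ {n : ℕ} (F : List (Subset n)) where
  open DecMembership {A = Subset n} (≡-dec Bool._≟_) using () renaming (_∈?_ to _∈ₗ?_)

  Axioms : Set
  Axioms = ⊥ ∈ₗ F × (∀ Y → Y ∈ₗ F → ∀ X → X ⊆ Y → X ∈ₗ F) ×
    (∀ X → X ∈ₗ F → ∀ Y → Y ∈ₗ F → ∣ X ∣ < ∣ Y ∣ → ∃[ x ] x ∈ Y × x ∉ X × X ∪ ⁅ x ⁆ ∈ₗ F)

  axiomsHold? : Dec Axioms
  axiomsHold? = (⊥ ∈ₗ? F) ×-dec
    allSubset? (λ Y → (Y ∈ₗ? F) →-dec allSubset? (λ X → (X ⊆? Y) →-dec (X ∈ₗ? F))) ×-dec
    allSubset? (λ X → (X ∈ₗ? F) →-dec allSubset? (λ Y → (Y ∈ₗ? F) →-dec ((∣ X ∣ <? ∣ Y ∣) →-dec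
      any? (λ x → (x ∈? Y) ×-dec ¬? (x ∈? X) ×-dec ((X ∪ ⁅ x ⁆) ∈ₗ? F)))))

  familyMatroid : Axioms → Matroid n
  familyMatroid (empty , hered , aug) = record
    { ground       = ⊤
    ; Indep        = _∈ₗ F
    ; indep?       = _∈ₗ? F
    ; indep⊆ground = λ _ → ⊆⊤
    ; ∅-indep      = empty
    ; hereditary   = λ iY → hered _ iY _
    ; augmentation = λ iX iY → aug _ iX _ iY
    }

  Represented : Set₁
  Represented = ∃[ M ] ∀ X → Indep (matroid {n} M) X ⇔ X ∈ₗ F

  axioms : Represented → Axioms
  axioms (M , M≐F) = to (M≐F _) (∅-indep K) ,
    (λ Y Y∈ X X⊆ → to (M≐F X) (hereditary K (from (M≐F Y) Y∈) X⊆)) ,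
    (λ X X∈ Y Y∈ lt → let x , x∈ , x∉ , i = augmentation K (from (M≐F X) X∈) (from (M≐F Y) Y∈) lt
                      in x , x∈ , x∉ , to (M≐F _) i)
    where K = matroid M

  -- Quantification over matroids is replaced by tests on the family itself: the axioms, rank 3 and,
  -- by `noTriangle⇔noMinor`, the absence of a triangle in place of that of the minors.
  represented? : Dec Represented
  represented? with axiomsHold?
  ... | no ¬ax = no (¬ax ∘ axioms)
  ... | yes ax with anySubset? (λ B → isBasisOf? (familyMatroid ax) ⊤ B ×-dec (∣ B ∣ ≟ 3))
  ...   | no ¬rank = no (λ (M , M≐F) → ¬rank (HasRank-resp {M = matroid M} {familyMatroid ax} M≐F (ground≡⊤ M) refl (rank3 M)))
  ...   | yes rank with Triangles.hasTriangle? (familyMatroid ax)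
  ...     | yes T = no (λ (M , M≐F) → noTriangle M (HasTriangle-resp {M = familyMatroid ax} {matroid M}
                      (≐-sym {M = matroid M} {familyMatroid ax} M≐F) T))
  ...     | no ¬T = yes (fromNoTriangle (familyMatroid ax) refl rank ¬T , λ _ → mk⇔ id id)

-- The independent sets of each member of the class form a sublist of the list of all subsets. One
-- matroid is chosen for each represented family, and duplicates are removed.
finitelyMany : ∀ n → ∃[ k ] HasCardinality (rank3Excluding𝒲³,M[K₄] n) k
finitelyMany n = finite (decSetoid n) (concatMap representative (sublists (subsets n))) λ M →
  let F = filter (indep? (matroid M)) (subsets n)
      M≐F = λ X → mk⇔ (∈-filter⁺ (indep? (matroid M)) (∈-subsets X)) (λ X∈ → proj₂ (∈-filter⁻ (indep? (matroid M)) {xs = subsets n} X∈))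
  in concatMap⁺ representative (lose (filter∈sublists (indep? (matroid M)) (subsets n)) (complete F M M≐F))
  where
  open Setoid (rank3Excluding𝒲³,M[K₄] n) using (_≈_)

  representative : List (Subset n) → List (Rank3Excluding𝒲³,M[K₄] n)
  representative F with represented? F
  ... | yes (M , _) = M ∷ []
  ... | no _        = []

  complete : ∀ F M → (∀ X → Indep (matroid M) X ⇔ X ∈ₗ F) → Any (M ≈_) (representative F)
  complete F M M≐F with represented? F
  ... | yes (N , N≐F) = here (λ X → mk⇔ (from (N≐F X) ∘ to (M≐F X)) (from (M≐F X) ∘ to (N≐F X)))
  ... | no ¬rep       = contradiction (M , M≐F) ¬rep

∣∣<⇒∃∉ : {X Y : Subset n} → ∣ X ∣ < ∣ Y ∣ → ∃[ x ] x ∈ Y × x ∉ X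
∣∣<⇒∃∉ {X = X} {Y} lt with any? (λ x → (x ∈? Y) ×-dec ¬? (x ∈? X))
... | yes found = found
... | no none   = contradiction (p⊆q⇒∣p∣≤∣q∣ (λ {x} x∈Y → decidable-stable (x ∈? X) (λ x∉X → none (x , x∈Y , x∉X)))) (<⇒≱ lt)

-- The elements of S are coloops and all others are loops.
freeOn : Subset n → Matroid n
freeOn S = record
  { ground       = ⊤
  ; Indep        = _⊆ S
  ; indep?       = _⊆? S
  ; indep⊆ground = λ _ → ⊆⊤
  ; ∅-indep      = ⊥⊆
  ; hereditary   = λ Y⊆S X⊆Y → Y⊆S ∘ X⊆Y
  ; augmentation = λ X⊆S Y⊆S lt → let x , x∈Y , x∉X = ∣∣<⇒∃∉ lt in x , x∈Y , x∉X , ∪-lub X⊆S (⁅⁆⊆ (Y⊆S x∈Y))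
  }

freeOn-rank : (S : Subset n) → HasRank (freeOn S) ∣ S ∣
freeOn-rank S = S , record { B⊆T = ⊆⊤ ; indep = id ; maximal = λ _ X⊆S _ → X⊆S } , refl

freeOn-noTriangle : (S : Subset n) → ¬ Triangles.HasTriangle (freeOn S)
freeOn-noTriangle S (a , b , c , d , e , f , (((a≢c ∷ _) ∷ _) , _) , ¬abc , _ , _ ,
  ((a≢b ∷ _) ∷ _ , ab⊆S) , ((b≢c ∷ _) ∷ _ , bc⊆S) , _) =
  ¬abc ((a≢b ∷ a≢c ∷ []) ∷ (b≢c ∷ []) ∷ [] ∷ [] , ∪-lub (ab⊆S ∘ p⊆p∪q _) bc⊆S)

-- Three coloops and n - 3 loops; this gives the positivity of the count that `Is2^o[_]` demands.
example : 3 ≤ n → Rank3Excluding𝒲³,M[K₄] n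
example (s≤s (s≤s (s≤s {n = n} _))) =
  fromNoTriangle (freeOn S) refl (subst (HasRank (freeOn S)) (cong (λ k → suc (suc (suc k))) (∣⊥∣≡0 n)) (freeOn-rank S))
    (freeOn-noTriangle S)
  where
  S = inside ∷ inside ∷ inside ∷ ⊥ {n}

-- Encoding by sparse bit strings and the final count

weight-does : {A : Set} {P : A → Set} (P? : Decidable P) (xs : List A) →
  weight (map (does ∘ P?) xs) ≡ ∑[ x ∈ xs ] 𝟙 (P? x)
weight-does P? []       = sym (∑-[] _)
weight-does P? (x ∷ xs) with P? x in eq
... | yes _ = trans (cong suc (weight-does P? xs)) (sym (trans (∑-∷ x xs _) (cong (_+ _) (cong 𝟙 eq))))
... | no _  = trans (weight-does P? xs) (sym (trans (∑-∷ x xs _) (cong (_+ _) (cong 𝟙 eq))))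

map-≡⇒≗ : {A B : Set} {f g : A → B} {xs : List A} → map f xs ≡ map g xs → ∀ {x} → x ∈ₗ xs → f x ≡ g x
map-≡⇒≗ {xs = _ ∷ _} eq (here refl) = proj₁ (∷-injective eq)
map-≡⇒≗ {xs = _ ∷ _} eq (there x∈)  = map-≡⇒≗ (proj₂ (∷-injective eq)) x∈

does-≡⇒ : {P Q : Set} (P? : Dec P) (Q? : Dec Q) → does P? ≡ does Q? → P → Q
does-≡⇒ _       (yes q) _  _ = q
does-≡⇒ (no ¬p) _       _  p = contradiction p ¬p
does-≡⇒ (yes _) (no _)  () _

-- `nothing` is the channel of the parallel classes and loops, `just s` that of a projection of the
-- consecutive triples.
Channel : Set
Channel = Maybe Edge

channels : List Channel
channels = nothing ∷ just edge₁₂ ∷ just edge₂₃ ∷ just edge₁₃ ∷ []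

∈-channels : ∀ c → c ∈ₗ channels
∈-channels nothing   = here refl
∈-channels (just edge₁₂) = there (here refl)
∈-channels (just edge₂₃) = there (there (here refl))
∈-channels (just edge₁₃) = there (there (there (here refl)))

length-cartesianProduct : {A B : Set} (xs : List A) (ys : List B) →
  length (cartesianProduct xs ys) ≡ length xs * length ys
length-cartesianProduct []       ys = refl
length-cartesianProduct (x ∷ xs) ys =
  trans (length-++ (map (x ,_) ys)) (cong₂ _+_ (length-map _ ys) (length-cartesianProduct xs ys))

∣allFin∣ : ∀ n → length (allFin n) ≡ n
∣allFin∣ n = length-tabulate id

positions : ∀ n → List (Channel × Fin n × Fin n)
positions n = cartesianProduct channels (cartesianProduct (allFin n) (allFin n))

∣positions∣ : ∀ n → length (positions n) ≡ 4 * (n * n)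
∣positions∣ n = trans (length-cartesianProduct channels (cartesianProduct (allFin n) (allFin n))) (cong (4 *_)
  (trans (length-cartesianProduct (allFin n) (allFin n)) (cong₂ _*_ (∣allFin∣ n) (∣allFin∣ n))))

module _ {n : ℕ} (M : Rank3Excluding𝒲³,M[K₄] n) where
  open Triangles (matroid M)

  reducedLines : LineSpace n
  reducedLines = lineSpace (noTriangle M)

  open LineSpace reducedLines using (Projection; projection?; size; linear∧triangleClosed; t)

  Relation : Channel × Fin n × Fin n → Set
  Relation (nothing , x , r) = RepOf x r
  Relation (just s  , x , y) = Projection s x y

  relation? : Decidable Relation
  relation? (nothing , x , r) = RepOf? x r
  relation? (just s  , x , y) = projection? s x y

  code : List Bool
  code = map (does ∘ relation?) (positions n)

  ∣code∣ : length code ≡ 4 * (n * n)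
  ∣code∣ = trans (length-map _ (positions n)) (∣positions∣ n)

  weight-code : ∀ m → m ≤ n → m * size ≤ n * n → m * weight code ≤ 4 * (n * n)
  weight-code m m≤n sparse = begin
    m * weight code                           ≡⟨ cong (m *_) (trans (weight-does relation? (positions n))
                                                   (trans (∑-cartesianProduct channels (cartesianProduct (allFin n) (allFin n)) _)
                                                     (∑-cong channels (λ c → ∑-cartesianProduct (allFin n) (allFin n) _)))) ⟩
    m * ∑ channels channelSize                ≤⟨ *-∑-≤ m channels channel≤ ⟩
    (∑[ _ ∈ channels ] (n * n))               ≡⟨ ∑-const channels (n * n) ⟩
    4 * (n * n)                               ∎
    where
    open ≤-Reasoning
    channelSize : Channel → ℕ
    channelSize c = ∑[ x ∈ allFin n ] ∑[ y ∈ allFin n ] 𝟙 (relation? (c , x , y))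
    channel≤ : ∀ c → m * channelSize c ≤ n * n
    channel≤ (just s) = ≤-trans (*-monoʳ-≤ m (∑projection reducedLines s)) sparse
    -- An element has at most one representative, so this channel has at most n ones, and m ≤ n.
    channel≤ nothing  = *-mono-≤ m≤n (≤-trans
      (∑-mono (allFin n) (λ x → ∑𝟙-unique (RepOf? x) (Uniqueₚ.allFin⁺ n) RepOf-unique))
      (≤-reflexive (trans (∑-const (allFin n) 1) (trans (*-identityʳ _) (∣allFin∣ n)))))

-- The first channel gives the representatives, the other three give the collinear triples by
-- `projections-determine`, and in rank 3 these determine all independent sets.
code-injective : {M N : Rank3Excluding𝒲³,M[K₄] n} → code M ≡ code N → Setoid._≈_ (rank3Excluding𝒲³,M[K₄] n) M N
code-injective {n} {M} {N} eq X = mk⇔ (half M N eq X) (half N M (sym eq) X)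
  where
  half : ∀ M N → code M ≡ code N → ∀ X → Indep (matroid M) X → Indep (matroid N) X
  half M N eq = Indep⊆ (matroid M) (matroid N)
    (λ xs (u , i) → ≤-trans (≤-reflexive (sym (∣fromList∣ u))) (rank-≤ (matroid M) (rank3 M) i))
    (relation⊆ M N eq nothing)
    (projections-determine (reducedLines N) (reducedLines M) (λ s → relation⊆ N M (sym eq) (just s)))
    where
    relation⊆ : ∀ M N → code M ≡ code N → ∀ c {x y} → Relation M (c , x , y) → Relation N (c , x , y)
    relation⊆ M N eq c {x} {y} = does-≡⇒ (relation? M (c , x , y)) (relation? N (c , x , y))
      (map-≡⇒≗ eq (∈-cartesianProduct⁺ (∈-channels c) (∈-cartesianProduct⁺ (∈-allFin x) (∈-allFin y))))

theorem3 : ∃[ count ] (∀ n → HasCardinality (rank3Excluding𝒲³,M[K₄] n) (count n)) × Is2^o[ (λ n → n ^ 2) ] count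
theorem3 = (λ n → proj₁ (finitelyMany n)) , (λ n → proj₂ (finitelyMany n)) , bound
  where
  bound : Is2^o[ (λ n → n ^ 2) ] (λ n → proj₁ (finitelyMany n))
  -- The threshold combines `N₀` for Ruzsa-Szemerédi, `m` for the channel of representatives and 3
  -- for `example`. As p ≥ 1, it suffices to reach the exponent n² / q.
  bound p q@(suc _) = N₀ ⊔ m ⊔ 3 , λ n N≤n →
    cardinality-positive (S n) (card n) (example (≤-trans (m≤n⊔m (N₀ ⊔ m) 3) N≤n)) ,
    (begin
      count n ^ q                                  ≤⟨ ^-monoˡ-≤ q (cardinality-≤ (S n) (card n) (light (4 * (n * n)) (4 * (n * n) / m)) code
                                                        (code∈light (≤-trans (m≤m⊔n (N₀ ⊔ m) 3) N≤n)) (λ {M} {N} → code-injective {M = M} {N})) ⟩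
      length (light (4 * (n * n)) (4 * (n * n) / m)) ^ q
                                                   ≤⟨ ∣light∣-small q (n * n) (4 * (n * n) / m)
                                                        (≤-trans (≤-reflexive (*-comm m _)) (m/n*n≤m (4 * (n * n)) m)) ⟩
      2 ^ (n * n)                                  ≤⟨ ^-monoʳ-≤ 2 (≤-trans (≤-reflexive (cong (n *_) (sym (*-identityʳ n)))) (m≤n*m (n ^ 2) p)) ⟩
      2 ^ (p * n ^ 2)                              ∎)
    where
    open ≤-Reasoning
    S = rank3Excluding𝒲³,M[K₄]
    count = λ n → proj₁ (finitelyMany n)
    card : ∀ n → HasCardinality (S n) (count n)
    card n = proj₂ (finitelyMany n)
    -- The sparsity required by `∣light∣-small`.
    m = 8 * rate q * q
    N₀ = proj₁ (ruzsa-szemerédi m)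

    code∈light : ∀ {n} → N₀ ⊔ m ≤ n → ∀ M → code M ∈ₗ light (4 * (n * n)) (4 * (n * n) / m)
    code∈light {n} N≤n M = subst (λ k → code M ∈ₗ light k w) (∣code∣ M) (∈-light (code M) (begin
      weight (code M)                ≡⟨ m*n/n≡m (weight (code M)) m ⟨
      weight (code M) * m / m        ≤⟨ /-monoˡ-≤ m (≤-trans (≤-reflexive (*-comm (weight (code M)) m))
                                          (weight-code M m (≤-trans (m≤n⊔m N₀ m) N≤n) sparse)) ⟩
      w                              ∎))
      where
      open LineSpace (reducedLines M)
      w = 4 * (n * n) / m
      sparse : m * size ≤ n * n
      sparse = proj₂ (ruzsa-szemerédi m) (≤-trans (m≤m⊔n N₀ m) N≤n) (allFin n) (allFin n) (allFin n)
        (∣allFin∣ n) (∣allFin∣ n) (∣allFin∣ n) t linear∧triangleClosed
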